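{- For any $\epsilon<1$ and any $n=\Omega\big((\frac{1}{\epsilon})^{\Theta(1/\epsilon)}\big)$, there is an $n$-vertex edge-weighted graph $G$ of treewidth at most $4$ such that every $(1+\epsilon)$-spanner of $G$ has lightness $\Omega(\frac{1}{\epsilon^2})$.
   Context: A $(1+\epsilon)$-spanner of an edge-weighted graph $G$ is a spanning subgraph $H$ with $d_H(u,v)\leq(1+\epsilon)d_G(u,v)$ for all vertices $u,v$; its lightness is $w(H)/w(\mathrm{MST}(G))$, where $w(H)$ is the total edge weight of $H$ and $\mathrm{MST}(G)$ is a minimum spanning tree of $G$.
   Formalization: The parameter ε is taken to be rational rather than real (the edge weights of the constructed graph are rational too, which loses nothing). -}

module Defs where

open import Data.Nat as ℕ using (ℕ; zero; suc; _∸_)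
open import Data.Bool using (Bool; true; false; _∧_; if_then_else_)
open import Data.Fin using (Fin; toℕ)
open import Data.List using (List; []; _∷_; foldr; map; concatMap; allFin)
open import Data.Integer using (+_)
open import Data.Rational using (ℚ; 0ℚ; 1ℚ; _+_; _*_; _<_; _≤_; _/_; 1/_; >-nonZero)
open import Data.Product using (_×_)
open import Relation.Binary.PropositionalEquality using (_≡_)

ℕ→ℚ : ℕ → ℚ
ℕ→ℚ k = + k / 1

_^ℚ_ : ℚ → ℕ → ℚ
q ^ℚ zero = 1ℚ
q ^ℚ suc k = q * (q ^ℚ k)

inv : (ε : ℚ) → 0ℚ < ε → ℚ
inv ε ε>0 = (1/ ε) {{>-nonZero ε>0}}

sumℚ : List ℚ → ℚ
sumℚ = foldr _+_ 0ℚ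

countTrue : List Bool → ℕ
countTrue = foldr (λ b k → if b then suc k else k) zero

pairsWith : ∀ {n} {A : Set} → (Fin n → Fin n → A) → List A
pairsWith {n} f = concatMap (λ u → concatMap (λ v → if toℕ u ℕ.<ᵇ toℕ v then (f u v ∷ []) else []) (allFin n)) (allFin n)

data Walk {n : ℕ} (E : Fin n → Fin n → Set) : Fin n → Fin n → Set where
  []  : ∀ {u} → Walk E u u
  _∷_ : ∀ {u v w} → E u v → Walk E v w → Walk E u w

walkWeight : ∀ {n} {E : Fin n → Fin n → Set} → (Fin n → Fin n → ℚ) → ∀ {u v} → Walk E u v → ℚ
walkWeight wt [] = 0ℚ
walkWeight wt (_∷_ {u} {v} _ p) = wt u v + walkWeight wt p

record SGraph (n : ℕ) : Set where
  field
    adj   : Fin n → Fin n → Bool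
    irrefl : ∀ u → adj u u ≡ false
    symm  : ∀ u v → adj u v ≡ adj v u

Edge : ∀ {n} → (Fin n → Fin n → Bool) → Fin n → Fin n → Set
Edge A u v = A u v ≡ true

edgeCount : ∀ {n} → (Fin n → Fin n → Bool) → ℕ
edgeCount A = countTrue (pairsWith A)

ConnectedAdj : ∀ {n} → (Fin n → Fin n → Bool) → Set
ConnectedAdj A = ∀ u v → Walk (Edge A) u v

IsTree : ∀ {m} → SGraph m → Set
IsTree {m} T = ConnectedAdj (SGraph.adj T) × edgeCount (SGraph.adj T) ≡ m ∸ 1

record WGraph (n : ℕ) : Set where
  field
    graph : SGraph n
    wt    : Fin n → Fin n → ℚ
    wt-symm : ∀ u v → wt u v ≡ wt v u
    wt-pos  : ∀ u v → SGraph.adj graph u v ≡ true → 0ℚ < wt u v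
  open SGraph graph public

Connected : ∀ {n} → WGraph n → Set
Connected G = ConnectedAdj (WGraph.adj G)

record Subgraph {n : ℕ} (G : WGraph n) : Set where
  field
    sel   : Fin n → Fin n → Bool
    sel-symm : ∀ u v → sel u v ≡ sel v u
    sel-sub  : ∀ u v → sel u v ≡ true → WGraph.adj G u v ≡ true

weight : ∀ {n} (G : WGraph n) → Subgraph G → ℚ
weight G H = sumℚ (pairsWith (λ u v → if Subgraph.sel H u v then WGraph.wt G u v else 0ℚ))

whole : ∀ {n} (G : WGraph n) → Subgraph G
whole G = record { sel = WGraph.adj G ; sel-symm = WGraph.symm G ; sel-sub = λ _ _ e → e }

-- distances: walks in G / in H, weighted by the weights of G
-- (d_X(u,v) is the minimum weight of a walk in X from u to v;
--  it is attained since weights are positive)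
WalkIn : ∀ {n} (G : WGraph n) → Subgraph G → Fin n → Fin n → Set
WalkIn G H = Walk (Edge (Subgraph.sel H))

-- H is a (1+ε)-spanner of G:  d_H(u,v) ≤ (1+ε) d_G(u,v) for all u, v,
-- written out via walks: for every walk p in G from u to v there is a
-- walk q in H from u to v with w(q) ≤ (1+ε) w(p).
IsSpanner : ∀ {n} (G : WGraph n) → ℚ → Subgraph G → Set
IsSpanner {n} G ε H = ∀ (u v : Fin n) (p : Walk (Edge (WGraph.adj G)) u v) →
  Data.Product.Σ (WalkIn G H u v) (λ q → walkWeight (WGraph.wt G) q ≤ (1ℚ + ε) * walkWeight (WGraph.wt G) p)

IsSpanningTree : ∀ {n} (G : WGraph n) → Subgraph G → Set
IsSpanningTree {n} G T = ConnectedAdj (Subgraph.sel T) × edgeCount (Subgraph.sel T) ≡ n ∸ 1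

IsMST : ∀ {n} (G : WGraph n) → Subgraph G → Set
IsMST G T = IsSpanningTree G T × (∀ T' → IsSpanningTree G T' → weight G T ≤ weight G T')

record TreeDecomposition {n : ℕ} (G : WGraph n) (k : ℕ) : Set where
  field
    m     : ℕ
    tree  : SGraph m
    isTree : IsTree tree
    bag   : Fin m → Fin n → Bool
    bagSize : ∀ i → countTrue (map (bag i) (allFin n)) ℕ.≤ suc k
    coverV : ∀ v → Data.Product.Σ (Fin m) (λ i → bag i v ≡ true)
    coverE : ∀ u v → WGraph.adj G u v ≡ true →
             Data.Product.Σ (Fin m) (λ i → bag i u ≡ true × bag i v ≡ true)
    subtree : ∀ v i j → bag i v ≡ true → bag j v ≡ true →
              Walk (λ a b → Edge (SGraph.adj tree) a b × bag a v ≡ true × bag b v ≡ true) i j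

TreewidthAtMost : ℕ → ∀ {n} → WGraph n → Set
TreewidthAtMost k G = TreeDecomposition G k

module Submission where

-- A unit-weight path carries m levels of chords, where m = ⌈1/ε⌉. A block consists of 2m sub-blocks, and chord j < m
-- joins the left end of sub-block j to the left end of sub-block m + j; its weight is (m - 1)D, where D is the distance
-- between the ends of a sub-block. Blocks become sub-blocks of the next level. Without that chord its endpoints are mD
-- apart, as a 1-Lipschitz potential shows, and (1 + ε)(m - 1) < m, so every spanner contains every chord. The chords of
-- a block overlap, so it has length (2m - 1)D rather than 2mD: over m levels this loses only a constant factor,
-- and each level weighs about m times the path. The treewidth bound comes from an elimination order which treats
-- a block as a ladder between its two halves, with the two halves' common end and the block's right end in every bag.

open import Defs

-- One level gives only lightness of order m: the m chords of a block weigh about mD each, over a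
-- length of about 2mD. A second factor m has to come from stacking levels, and each coarser level
-- counts for `G / K = 1 - 1/(2m)` of the one below it, relative to the path. These factors form a
-- geometric series with sum `K = 2m`, so m levels already collect a constant fraction of all that
-- stacking can give; they need `K ^ m = (2m)^m` vertices, which is the source of the bound on n.
-- Distances are never computed. A finer level only subdivides the unit steps of a coarser one, so a
-- potential for a coarse chord is carried down by multiplying it by `G` and interpolating inside
-- blocks, and local Lipschitz checks rule out all detours at once. The minimum spanning tree is
-- only compared with the path, which bounds it from above.

module Construction where

  open import Data.Nat
  open import Data.Nat.Properties
  open import Data.Nat.DivMod
  import Data.Nat.Coprimality as Coprime
  open import Data.Nat.Tactic.RingSolver using (solve-∀)
  import Data.Integer as ℤ
  import Data.Integer.Properties as ℤ
  open import Data.Rational as ℚ using (ℚ; 0ℚ; 1ℚ; mkℚ)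
  import Data.Rational.Properties as ℚ
  import Data.Rational.Unnormalised as ℚᵘ
  import Data.Rational.Unnormalised.Properties as ℚᵘ
  open import Data.Bool using (Bool; true; false; if_then_else_; _∧_; _∨_; not; T)
  import Data.Bool.Properties as 𝔹
  open import Data.Fin as Fin using (Fin; toℕ)
  import Data.Fin.Properties as Fin
  open import Data.List using (List; []; _∷_; _++_; concatMap; map; tabulate; length)
  open import Data.List.Properties using (length-map)
  open import Data.List.Relation.Unary.Any using (here; there)
  open import Data.List.Membership.Propositional using (_∈_)
  open import Data.List.Membership.Propositional.Properties using (∈-map⁺; ∈-map⁻)
  open import Data.List.Membership.DecPropositional _≟_ using (_∈?_)
  open import Data.Product using (Σ; ∃-syntax; _×_; _,_; proj₁; proj₂)
  open import Data.Sum using (_⊎_; inj₁; inj₂)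
  open import Data.Empty using (⊥; ⊥-elim)
  open import Data.Unit using (⊤; tt)
  open import Function using (_∘_; id)
  open import Relation.Nullary using (¬_; yes; no; does)
  open import Relation.Nullary.Decidable using (dec-true; dec-false; toWitness)
  open import Relation.Binary using (tri<; tri≈; tri>)
  open import Relation.Binary.PropositionalEquality
  open import Algebra.Properties.Semiring.Sum +-*-semiring using (sum; sum-cong-≗; ∑-distrib-+; ∑-comm; *-distribˡ-sum)

  -- Finite sums and trees

  pairSum : ∀ {n} → (Fin n → Fin n → ℕ) → ℕ
  pairSum g = sum λ u → sum λ v → if toℕ u <ᵇ toℕ v then g u v else 0

  module _ {A : Set} (R : List A → ℕ → Set) (R-[] : R [] 0)
           (R-++ : ∀ {xs ys a b} → R xs a → R ys b → R (xs ++ ys) (a + b)) where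

    concatMap-sum : ∀ {n} {B : Set} (e : Fin n → B) (h : B → List A) {g : Fin n → ℕ} →
      (∀ i → R (h (e i)) (g i)) → R (concatMap h (tabulate e)) (sum g)
    concatMap-sum {zero} e h r = R-[]
    concatMap-sum {suc n} e h r = R-++ (r Fin.zero) (concatMap-sum (e ∘ Fin.suc) h (r ∘ Fin.suc))

    -- `R xs k` reads as: k is the total of the list xs. One proof thereby serves both `countTrue`,
    -- for numbers of edges, and `sumℚ`, for weights.
    pairsWith-pairSum : ∀ {n} {f : Fin n → Fin n → A} {g : Fin n → Fin n → ℕ} →
      (∀ u v → R (f u v ∷ []) (g u v)) → R (pairsWith f) (pairSum g)
    pairsWith-pairSum {f = f} {g} r = concatMap-sum id _ λ u → concatMap-sum id _ λ v → single u v
      where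
      single : ∀ u v → R (if toℕ u <ᵇ toℕ v then f u v ∷ [] else []) (if toℕ u <ᵇ toℕ v then g u v else 0)
      single u v with toℕ u <ᵇ toℕ v
      ... | true = r u v
      ... | false = R-[]

  𝟙 : Bool → ℕ
  𝟙 b = if b then 1 else 0

  countTrue-++ : ∀ {xs ys a b} → countTrue xs ≡ a → countTrue ys ≡ b → countTrue (xs ++ ys) ≡ a + b
  countTrue-++ {[]} refl refl = refl
  countTrue-++ {true ∷ xs} refl refl = cong suc (countTrue-++ {xs} refl refl)
  countTrue-++ {false ∷ xs} refl refl = countTrue-++ {xs} refl refl

  edgeCount-pairSum : ∀ {n} (A : Fin n → Fin n → Bool) → edgeCount A ≡ pairSum (λ u v → 𝟙 (A u v))
  edgeCount-pairSum A = pairsWith-pairSum (λ xs k → countTrue xs ≡ k) refl (λ {xs} → countTrue-++ {xs}) single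
    where
    single : ∀ u v → countTrue (A u v ∷ []) ≡ 𝟙 (A u v)
    single u v with A u v
    ... | true = refl
    ... | false = refl

  sum-mono : ∀ {n} {f g : Fin n → ℕ} → (∀ i → f i ≤ g i) → sum f ≤ sum g
  sum-mono {zero} h = z≤n
  sum-mono {suc n} h = +-mono-≤ (h Fin.zero) (sum-mono (h ∘ Fin.suc))

  sum-≥-term : ∀ {n} (f : Fin n → ℕ) i → f i ≤ sum f
  sum-≥-term f Fin.zero = m≤m+n _ _
  sum-≥-term f (Fin.suc i) = m≤n⇒m≤o+n _ (sum-≥-term (f ∘ Fin.suc) i)

  sum-zero : ∀ {n} {f : Fin n → ℕ} → (∀ i → f i ≡ 0) → sum f ≡ 0
  sum-zero {zero} h = refl
  sum-zero {suc n} h rewrite h Fin.zero = sum-zero (h ∘ Fin.suc)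

  sum-const : ∀ n c → sum {n} (λ _ → c) ≡ n * c
  sum-const zero c = refl
  sum-const (suc n) c = cong (c +_) (sum-const n c)

  <ᵇ-true : ∀ {m n} → m < n → (m <ᵇ n) ≡ true
  <ᵇ-true {m} {n} p with m <ᵇ n | <⇒<ᵇ p
  ... | true | _ = refl

  <ᵇ-false : ∀ {m n} → ¬ m < n → (m <ᵇ n) ≡ false
  <ᵇ-false {m} {n} p with m <ᵇ n | <ᵇ⇒< m n
  ... | true | q = ⊥-elim (p (q _))
  ... | false | _ = refl

  ≡ᵇ-refl : ∀ x → (x ≡ᵇ x) ≡ true
  ≡ᵇ-refl zero = refl
  ≡ᵇ-refl (suc x) = ≡ᵇ-refl x

  ≡ᵇ-false : ∀ {x y} → x ≢ y → (x ≡ᵇ y) ≡ false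
  ≡ᵇ-false {x} {y} ne with x ≡ᵇ y in e
  ... | true = ⊥-elim (ne (≡ᵇ⇒≡ x y (subst T (sym e) tt)))
  ... | false = refl

  -- The terms `p v u` over pairs u < v become, after exchanging the two sums, the terms `p u v`
  -- over pairs v < u; the diagonal vanishes.
  pairSum-symmetrize : ∀ {n} (p : Fin n → Fin n → ℕ) → (∀ u → p u u ≡ 0) →
    pairSum (λ u v → p u v + p v u) ≡ (sum λ u → sum λ v → p u v)
  pairSum-symmetrize {n} p p0 = begin
    pairSum (λ u v → p u v + p v u)
      ≡⟨ sum-cong-≗ (λ u → trans (sum-cong-≗ (λ v → split u v)) (∑-distrib-+ {n} _ _)) ⟩
    sum (λ u → sum (λ v → below u v (p u v)) + sum (λ v → below u v (p v u)))
      ≡⟨ ∑-distrib-+ {n} _ _ ⟩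
    sum (λ u → sum (λ v → below u v (p u v))) + sum (λ u → sum (λ v → below u v (p v u)))
      ≡⟨ cong (sum (λ u → sum (λ v → below u v (p u v))) +_) (∑-comm {n} {n} (λ u v → below u v (p v u))) ⟩
    sum (λ u → sum (λ v → below u v (p u v))) + sum (λ v → sum (λ u → below u v (p v u)))
      ≡⟨ ∑-distrib-+ {n} _ _ ⟨
    sum (λ u → sum (λ v → below u v (p u v)) + sum (λ v → below v u (p u v)))
      ≡⟨ sum-cong-≗ (λ u → trans (sym (∑-distrib-+ {n} _ _)) (sum-cong-≗ (λ v → merge u v))) ⟩
    sum (λ u → sum λ v → p u v) ∎
    where
    open ≡-Reasoning
    below : Fin n → Fin n → ℕ → ℕ
    below u v x = if toℕ u <ᵇ toℕ v then x else 0
    split : ∀ u v → below u v (p u v + p v u) ≡ below u v (p u v) + below u v (p v u)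
    split u v with toℕ u <ᵇ toℕ v
    ... | true = refl
    ... | false = refl
    merge : ∀ u v → below u v (p u v) + below v u (p u v) ≡ p u v
    merge u v with <-cmp (toℕ u) (toℕ v)
    ... | tri< a _ c rewrite <ᵇ-true a | <ᵇ-false c = +-identityʳ _
    ... | tri> a _ c rewrite <ᵇ-true c | <ᵇ-false a = refl
    ... | tri≈ a b c rewrite <ᵇ-false a | <ᵇ-false c | Fin.toℕ-injective b = sym (p0 v)

  sum-indicator : ∀ {n} (i : Fin n) (c : Bool) → sum (λ j → 𝟙 (c ∧ does (i Fin.≟ j))) ≡ 𝟙 c
  sum-indicator {n} i false = sum-zero {n} (λ _ → refl)
  sum-indicator {suc n} Fin.zero true = cong suc (sum-zero {n} (λ _ → refl))
  sum-indicator (Fin.suc i) true = sum-indicator i true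

  -- Walks, and trees given by a parent map

  _++ʷ_ : ∀ {n} {E : Fin n → Fin n → Set} {u v w} → Walk E u v → Walk E v w → Walk E u w
  [] ++ʷ q = q
  (e ∷ p) ++ʷ q = e ∷ (p ++ʷ q)

  reverse-walk : ∀ {n} {E : Fin n → Fin n → Set} → (∀ {a b} → E a b → E b a) → ∀ {u v} → Walk E u v → Walk E v u
  reverse-walk s [] = []
  reverse-walk s (e ∷ p) = reverse-walk s p ++ʷ (s e ∷ [])

  map-walk : ∀ {n} {E F : Fin n → Fin n → Set} → (∀ {a b} → E a b → F a b) → ∀ {u v} → Walk E u v → Walk F u v
  map-walk s [] = []
  map-walk s (e ∷ p) = s e ∷ map-walk s p

  module ParentTree {m : ℕ} (par : Fin (suc m) → Fin (suc m)) (rank : Fin (suc m) → ℕ)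
                    (rank-par : ∀ v → v ≢ Fin.zero → rank (par v) < rank v) where

    child : Fin (suc m) → Fin (suc m) → Bool
    child u v = not (does (v Fin.≟ Fin.zero)) ∧ does (par v Fin.≟ u)

    child-par : ∀ v → v ≢ Fin.zero → child (par v) v ≡ true
    child-par v v≢0 rewrite dec-false (v Fin.≟ Fin.zero) v≢0 | dec-true (par v Fin.≟ par v) refl = refl

    child-inv : ∀ u v → child u v ≡ true → v ≢ Fin.zero × par v ≡ u
    child-inv u v e with v Fin.≟ Fin.zero | par v Fin.≟ u
    ... | no p | yes q = p , q

    child-rank : ∀ u v → child u v ≡ true → rank u < rank v
    child-rank u v e with child-inv u v e
    ... | p , refl = rank-par v p

    child-irrefl : ∀ u → child u u ≡ false
    child-irrefl u with child u u in eq
    ... | true = ⊥-elim (<-irrefl refl (child-rank u u eq))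
    ... | false = refl

    tree : SGraph (suc m)
    tree = record
      { adj = λ u v → child u v ∨ child v u
      ; irrefl = λ u → cong₂ _∨_ (child-irrefl u) (child-irrefl u)
      ; symm = λ u v → 𝔹.∨-comm (child u v) (child v u) }

    open SGraph tree using (adj)

    adj-par : ∀ v → v ≢ Fin.zero → adj v (par v) ≡ true
    adj-par v v≢0 rewrite child-par v v≢0 = 𝔹.∨-zeroʳ _

    -- Every vertex other than the root accounts for exactly one edge, the one to its parent. As
    -- ranks drop towards the parent, no edge is accounted for from both ends.
    edges : edgeCount adj ≡ m
    edges = begin
      edgeCount adj                               ≡⟨ edgeCount-pairSum adj ⟩
      pairSum (λ u v → 𝟙 (adj u v))               ≡⟨ pairSum-cong ⟩
      pairSum (λ u v → p u v + p v u)             ≡⟨ pairSum-symmetrize p (λ u → cong 𝟙 (child-irrefl u)) ⟩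
      sum (λ u → sum λ v → p u v)                 ≡⟨ ∑-comm p ⟩
      sum (λ v → sum λ u → p u v)                 ≡⟨ sum-cong-≗ (λ v → sum-indicator (par v) (not (does (v Fin.≟ Fin.zero)))) ⟩
      sum (λ (v : Fin (suc m)) → 𝟙 (not (does (v Fin.≟ Fin.zero)))) ≡⟨ trans (sum-const m 1) (*-identityʳ m) ⟩
      m ∎
      where
      open ≡-Reasoning
      p : Fin (suc m) → Fin (suc m) → ℕ
      p u v = 𝟙 (child u v)
      or-plus : ∀ u v → 𝟙 (adj u v) ≡ p u v + p v u
      or-plus u v with child u v in e₁ | child v u in e₂
      ... | true | true = ⊥-elim (<-asym (child-rank u v e₁) (child-rank v u e₂))
      ... | true | false = refl
      ... | false | true = refl
      ... | false | false = refl
      pairSum-cong : pairSum (λ u v → 𝟙 (adj u v)) ≡ pairSum (λ u v → p u v + p v u)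
      pairSum-cong = sum-cong-≗ λ u → sum-cong-≗ λ v → cong (λ x → if toℕ u <ᵇ toℕ v then x else 0) (or-plus u v)

    module _ (P : Fin (suc m) → Set) (x : Fin (suc m)) (closed : ∀ v → P v → v ≢ x → v ≢ Fin.zero × P (par v)) where

      -- Serves twice: with P the whole tree and x the root for connectedness, and with P the bags
      -- that contain a given vertex for the subtree condition.
      walk-up : ∀ v → P v → Walk (λ a b → Edge adj a b × P a × P b) v x
      walk-up v pv = go (suc (rank v)) v pv ≤-refl
        where
        go : ∀ k v → P v → rank v < k → Walk (λ a b → Edge adj a b × P a × P b) v x
        go (suc k) v pv r with v Fin.≟ x
        ... | yes refl = []
        ... | no v≢x with closed v pv v≢x
        ...   | v≢0 , pp = (adj-par v v≢0 , pv , pp) ∷ go k (par v) pp (<-≤-trans (rank-par v v≢0) (s≤s⁻¹ r))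

    isTree : IsTree tree
    isTree = conn , edges
      where
      up : ∀ v → Walk (Edge adj) v Fin.zero
      up v = map-walk proj₁ (walk-up (λ _ → ⊤) Fin.zero (λ _ _ z → z , _) v _)
      conn : ConnectedAdj adj
      conn u v = up u ++ʷ reverse-walk (λ {a} {b} e → trans (SGraph.symm tree b a) e) (up v)

  -- Sums over initial segments of the naturals

  Σ< : ∀ n → (ℕ → ℕ) → ℕ
  Σ< n f = sum {n} (λ i → f (toℕ i))

  Σ<-+ : ∀ a b f → Σ< (a + b) f ≡ Σ< a f + Σ< b (λ i → f (a + i))
  Σ<-+ zero b f = refl
  Σ<-+ (suc a) b f = trans (cong (f 0 +_) (Σ<-+ a b (f ∘ suc))) (sym (+-assoc (f 0) _ _))

  Σ<-≤ : ∀ a b f → Σ< a f ≤ Σ< (a + b) f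
  Σ<-≤ a b f = ≤-trans (m≤m+n _ _) (≤-reflexive (sym (Σ<-+ a b f)))

  Σ<-≥-term : ∀ n f {i} → i < n → f i ≤ Σ< n f
  Σ<-≥-term n f i<n = subst (λ x → f x ≤ Σ< n f) (Fin.toℕ-fromℕ< i<n) (sum-≥-term (λ (j : Fin n) → f (toℕ j)) (Fin.fromℕ< i<n))

  Σ<-blocks : ∀ X K f → Σ< (X * K) f ≡ Σ< X λ q → Σ< K λ r → f (r + q * K)
  Σ<-blocks zero K f = refl
  Σ<-blocks (suc X) K f = begin
    Σ< (K + X * K) f
      ≡⟨ Σ<-+ K (X * K) f ⟩
    Σ< K f + Σ< (X * K) (λ i → f (K + i))
      ≡⟨ cong (Σ< K f +_) (Σ<-blocks X K (λ i → f (K + i))) ⟩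
    Σ< K f + (Σ< X λ q → Σ< K λ r → f (K + (r + q * K)))
      ≡⟨ cong₂ _+_ (sum-cong-≗ {K} λ r → cong f (sym (+-identityʳ (toℕ r))))
                   (sum-cong-≗ {X} λ q → sum-cong-≗ {K} λ r → cong f (shift (toℕ r) (toℕ q * K))) ⟩
    (Σ< (suc X) λ q → Σ< K λ r → f (r + q * K)) ∎
    where
    open ≡-Reasoning
    shift : ∀ r x → K + (r + x) ≡ r + (K + x)
    shift r x = trans (sym (+-assoc K r x)) (trans (cong (_+ x) (+-comm K r)) (+-assoc r K x))

  -- Chords

  module Chords (h : ℕ) where

    p m K G : ℕ
    p = suc h
    m = suc p
    K = m + m
    G = p + m

    -- Levels are added at the fine end: from L to `suc L` every unit step becomes a block of K unit
    -- steps. Old positions are thus multiplied by K, but old lengths only by `G`, the length of a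
    -- block with its chords; the new chords have D = 1.
    data Chord : ℕ → ℕ → ℕ → ℕ → Set where
      bottom : ∀ {L a} q j → j < m → a ≡ j + q * K → Chord (suc L) a (m + a) p
      up     : ∀ {L a b w} → Chord L a b w → Chord (suc L) (a * K) (b * K) (G * w)

    -- Because a chord is never as short as a path edge, path edges and chords can share one weight
    -- function.
    chord-long : ∀ {L a b w} → Chord L a b w → suc a < b
    chord-long (bottom q j _ _) = s≤s (s≤s (m≤n+m _ h))
    chord-long (up {a = a} {b} c) = begin-strict
      suc (a * K)   <⟨ s≤s (s≤s (m≤n+m _ _)) ⟩
      K + a * K     ≡⟨⟩
      suc a * K     ≤⟨ *-monoˡ-≤ K (<⇒≤ (chord-long c)) ⟩
      b * K         ∎
      where open ≤-Reasoning

    chord-weight : ∀ {L a b w} → Chord L a b w → 1 ≤ w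
    chord-weight (bottom _ _ _ _) = s≤s z≤n
    chord-weight (up c) = *-mono-≤ {1} {G} (s≤s z≤n) (chord-weight c)

    -- Blocks, and potentials that bound detours

    block-/ : ∀ q {r} → r < K → (r + q * K) / K ≡ q
    block-/ q {r} r<K = begin
      (r + q * K) / K      ≡⟨ +-distrib-/ r (q * K) small ⟩
      r / K + q * K / K    ≡⟨ cong₂ _+_ (m<n⇒m/n≡0 r<K) (m*n/n≡m q K) ⟩
      q                    ∎
      where
      open ≡-Reasoning
      small : r % K + q * K % K < K
      small = subst (_< K) (sym (trans (cong₂ _+_ (m<n⇒m%n≡m r<K) (m*n%n≡0 q K)) (+-identityʳ r))) r<K

    block-% : ∀ q {r} → r < K → (r + q * K) % K ≡ r
    block-% q {r} r<K = trans ([m+kn]%n≡m%n r q K) (m<n⇒m%n≡m r<K)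

    m<K : m < K
    m<K = m<m+n m (s≤s z≤n)

    -- A certificate that every walk from u to v without the chord between them weighs at least
    -- `f v`. With w = pD, `at-v` says that this is mD, without a division.
    record Potential (L u v w : ℕ) : Set where
      field
        f     : ℕ → ℕ
        step↑ : ∀ a → f (suc a) ≤ suc (f a)
        step↓ : ∀ a → f a ≤ suc (f (suc a))
        lip   : ∀ {a b x} → Chord L a b x → ¬ (a ≡ u × b ≡ v) → f a ≤ f b + x × f b ≤ f a + x
        at-u  : f u ≡ 0
        at-v  : p * f v ≡ m * w

    module Bottom (u : ℕ) where

      -- Only u lies at height 0. All other values are between 1 and m, so a chord of weight
      -- `p = m - 1` that misses u cannot be too steep, while unit steps still climb from 0 at u to
      -- m at `m + u`.
      f : ℕ → ℕ
      f a with a <? u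
      ... | yes _ = 1
      ... | no _  = (a ∸ u) ⊓ m

      f≤m : ∀ a → f a ≤ m
      f≤m a with a <? u
      ... | yes _ = s≤s z≤n
      ... | no _ = m⊓n≤n (a ∸ u) m

      f≥1 : ∀ a → a ≢ u → 1 ≤ f a
      f≥1 a a≢u with a <? u
      ... | yes _ = s≤s z≤n
      ... | no a≮u = ⊓-mono-≤ (m<n⇒0<n∸m (≤∧≢⇒< (≮⇒≥ a≮u) (a≢u ∘ sym))) (s≤s z≤n)

      f-left : ∀ a → a < u → f a ≡ 1
      f-left a a<u with a <? u
      ... | yes _ = refl
      ... | no a≮u = ⊥-elim (a≮u a<u)

      f-right : ∀ x → f (x + u) ≡ x ⊓ m
      f-right x with x + u <? u
      ... | yes q = ⊥-elim (m+n≮n x u q)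
      ... | no _ = cong (_⊓ m) (m+n∸n≡m x u)

      data View : ℕ → Set where
        left  : ∀ {a} → a < u → View a
        right : ∀ x → View (x + u)

      view : ∀ a → View a
      view a with a <? u
      ... | yes a<u = left a<u
      ... | no a≮u = subst View (m∸n+n≡m (≮⇒≥ a≮u)) (right (a ∸ u))

      step↑ : ∀ a → f (suc a) ≤ suc (f a)
      step↑ a with view a
      ... | right x rewrite f-right (suc x) | f-right x = ⊓-mono-≤ {suc x} ≤-refl (n≤1+n m)
      ... | left a<u rewrite f-left a a<u with suc a ≟ u
      ...   | yes refl rewrite f-right 0 = z≤n
      ...   | no ne rewrite f-left (suc a) (≤∧≢⇒< a<u ne) = s≤s z≤n

      step↓ : ∀ a → f a ≤ suc (f (suc a))
      step↓ a with view a
      ... | right x rewrite f-right (suc x) | f-right x = ≤-trans (⊓-monoˡ-≤ m (n≤1+n x)) (n≤1+n _)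
      ... | left a<u rewrite f-left a a<u = s≤s z≤n

      lip : ∀ {L a b x} → Chord (suc L) a b x → ¬ (a ≡ u × b ≡ m + u) → f a ≤ f b + x × f b ≤ f a + x
      lip {a = a} (bottom q j _ _) ne = down , ≤-trans (f≤m (m + a)) (+-monoˡ-≤ p (f≥1 a a≢u))
        where
        a≢u : a ≢ u
        a≢u refl = ne (refl , refl)
        down : f a ≤ f (m + a) + p
        -- A chord may also end at u; its left end then has height 1, which is at most `p`.
        down with m + a ≟ u
        ... | yes e = ≤-trans (≤-reflexive (f-left a (subst (a <_) e (m<n+m a (s≤s z≤n))))) (m≤n⇒m≤o+n _ (s≤s z≤n))
        ... | no ne′ = ≤-trans (f≤m a) (+-monoˡ-≤ p (f≥1 (m + a) ne′))
      lip {a = a} {b} (up {w = w} c) _ = m≤n⇒m≤o+n (f b) (≤-trans (f≤m a) big) , m≤n⇒m≤o+n (f a) (≤-trans (f≤m b) big)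
        where
        -- Chords of coarser levels weigh at least `G`, more than the whole range of `f`.
        big : m ≤ G * w
        big = ≤-trans (≤-trans (m≤n+m m p) (≤-reflexive (sym (*-identityʳ G)))) (*-monoʳ-≤ G (chord-weight c))

      potential : ∀ {L} → Potential (suc L) u (m + u) p
      potential = record
        { f = f ; step↑ = step↑ ; step↓ = step↓ ; lip = lip ; at-u = f-right 0
        ; at-v = trans (cong (p *_) (trans (f-right m) (⊓-idem m))) (*-comm p m) }

    -- Distance from the left end inside a block of K unit steps: the shortest way takes exactly one chord,
    -- of weight m - 1 instead of m, so the whole block has length G = K - 1.
    g : ℕ → ℕ
    g r = r ⊓ p + (r ∸ m)

    g-low : ∀ {r} → r < m → g r ≡ r
    g-low {r} r<m = trans (cong₂ _+_ (m≤n⇒m⊓n≡m (s≤s⁻¹ r<m)) (m≤n⇒m∸n≡0 (<⇒≤ r<m))) (+-identityʳ r)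

    g-high : ∀ j → g (m + j) ≡ p + j
    g-high j = cong₂ _+_ (m≥n⇒m⊓n≡n {m + j} (≤-trans (n≤1+n p) (m≤m+n m j))) (m+n∸m≡n m j)

    g-step : ∀ r → g (suc r) ≡ g r ⊎ g (suc r) ≡ suc (g r)
    g-step r with r <? p
    ... | yes r<p = inj₂ (trans (g-low (s≤s r<p)) (cong suc (sym (g-low (m<n⇒m<1+n r<p)))))
    ... | no r≮p with r ≟ p
    ...   | yes refl = inj₁ (trans (trans (cong g (sym (+-identityʳ m))) (g-high 0)) (trans (+-identityʳ p) (sym (g-low ≤-refl))))
    ...   | no r≢p = inj₂ (subst (λ x → g (suc x) ≡ suc (g x)) (m+[n∸m]≡n {m} {r} (≤∧≢⇒< (≮⇒≥ r≮p) (r≢p ∘ sym))) high)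
      where
      high : g (suc (m + (r ∸ m))) ≡ suc (g (m + (r ∸ m)))
      high = trans (cong g (sym (+-suc m _))) (trans (g-high _) (trans (+-suc p _) (cong suc (sym (g-high _)))))

    g≤G : ∀ {r} → r ≤ K → g r ≤ G
    g≤G {r} r≤K = +-mono-≤ (m⊓n≤n r p) (≤-trans (∸-monoˡ-≤ m r≤K) (≤-reflexive (m+n∸m≡n m m)))

    between : ℕ → ℕ → ℕ → ℕ
    between A B x = A * (G ∸ x) + B * x

    -- Raising x by d moves d units of weight from A to B, which changes the value by d times the
    -- difference of B and A.
    between-lip : ∀ {A B} x d → x + d ≤ G → A ≤ suc B → B ≤ suc A →
      between A B x ≤ between A B (x + d) + d × between A B (x + d) ≤ between A B x + d
    between-lip {A} {B} x d x+d≤G A≤B B≤A = subst₂ (λ s t → A * s + B * x ≤ A * t + B * (x + d) + d × A * t + B * (x + d) ≤ A * s + B * x + d)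
        gap refl (lo , hi)
      where
      z = G ∸ (x + d)
      gap : d + z ≡ G ∸ x
      gap = trans (cong (d +_) (sym (∸-+-assoc G x d))) (m+[n∸m]≡n (subst (_≤ G ∸ x) (m+n∸m≡n x d) (∸-monoˡ-≤ x x+d≤G)))
      open ≤-Reasoning
      lo : A * (d + z) + B * x ≤ A * z + B * (x + d) + d
      lo = begin
        A * (d + z) + B * x            ≡⟨ ring₁ A B x d z ⟩
        A * d + (A * z + B * x)        ≤⟨ +-monoˡ-≤ _ (*-monoˡ-≤ d A≤B) ⟩
        suc B * d + (A * z + B * x)    ≡⟨ ring₂ A B x d z ⟩
        A * z + B * (x + d) + d        ∎
        where
        ring₁ : ∀ A B x d z → A * (d + z) + B * x ≡ A * d + (A * z + B * x)
        ring₁ = solve-∀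
        ring₂ : ∀ A B x d z → suc B * d + (A * z + B * x) ≡ A * z + B * (x + d) + d
        ring₂ = solve-∀
      hi : A * z + B * (x + d) ≤ A * (d + z) + B * x + d
      hi = begin
        A * z + B * (x + d)            ≡⟨ ring₁ A B x d z ⟩
        B * d + (A * z + B * x)        ≤⟨ +-monoˡ-≤ _ (*-monoˡ-≤ d B≤A) ⟩
        suc A * d + (A * z + B * x)    ≡⟨ ring₂ A B x d z ⟩
        A * (d + z) + B * x + d        ∎
        where
        ring₁ : ∀ A B x d z → A * z + B * (x + d) ≡ B * d + (A * z + B * x)
        ring₁ = solve-∀
        ring₂ : ∀ A B x d z → suc A * d + (A * z + B * x) ≡ A * (d + z) + B * x + d
        ring₂ = solve-∀

    module Up {L u v w : ℕ} (P : Potential L u v w) where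
      private module P = Potential P

      -- A vertex of the coarser level gets its old value times `G`. Inside a block the value is
      -- interpolated along `g`, so a change of at most 1 per old unit step becomes a slope of at
      -- most 1.
      f : ℕ → ℕ
      f a = between (P.f (a / K)) (P.f (suc (a / K))) (g (a % K))

      f-inside : ∀ q {r} → r < K → f (r + q * K) ≡ between (P.f q) (P.f (suc q)) (g r)
      f-inside q r<K = cong₂ (λ x y → between (P.f x) (P.f (suc x)) (g y)) (block-/ q r<K) (block-% q r<K)

      f-mul : ∀ q → f (q * K) ≡ P.f q * G
      f-mul q = trans (f-inside q (s≤s z≤n)) (trans (cong (P.f q * G +_) (*-zeroʳ (P.f (suc q)))) (+-identityʳ _))

      -- The right end of block q is position K of this block as well as position 0 of the next one.
      -- Admitting r = K keeps every unit step inside a single block.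
      f-block : ∀ q {r} → r ≤ K → f (r + q * K) ≡ between (P.f q) (P.f (suc q)) (g r)
      f-block q {r} r≤K with m≤n⇒m<n∨m≡n r≤K
      ... | inj₁ r<K = f-inside q r<K
      ... | inj₂ refl = begin
        f (suc q * K)                                 ≡⟨ f-mul (suc q) ⟩
        P.f (suc q) * G                               ≡⟨ cong (_+ P.f (suc q) * G) (*-zeroʳ (P.f q)) ⟨
        P.f q * 0 + P.f (suc q) * G                   ≡⟨ cong (λ x → P.f q * x + P.f (suc q) * G) (n∸n≡0 G) ⟨
        between (P.f q) (P.f (suc q)) G               ≡⟨ cong (between (P.f q) (P.f (suc q))) (g-high m) ⟨
        between (P.f q) (P.f (suc q)) (g K)           ∎
        where open ≡-Reasoning

      f-lip : ∀ q r r′ d → r′ ≤ K → r ≤ K → g r′ ≡ g r + d →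
        f (r + q * K) ≤ f (r′ + q * K) + d × f (r′ + q * K) ≤ f (r + q * K) + d
      f-lip q r r′ d r′≤K r≤K e rewrite f-block q r≤K | f-block q r′≤K | e =
        between-lip (g r) d (subst (_≤ G) e (g≤G r′≤K)) (P.step↓ q) (P.step↑ q)

      step : ∀ a → f a ≤ suc (f (suc a)) × f (suc a) ≤ suc (f a)
      step a = subst (λ b → f b ≤ suc (f (suc b)) × f (suc b) ≤ suc (f b)) (sym (m≡m%n+[m/n]*n a K)) in-block
        where
        r = a % K
        q = a / K
        r<K = m%n<n a K
        in-block : f (r + q * K) ≤ suc (f (suc r + q * K)) × f (suc r + q * K) ≤ suc (f (r + q * K))
        slack : ∀ x y {d} → d ≤ 1 → x ≤ y + d × y ≤ x + d → x ≤ suc y × y ≤ suc x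
        slack x y d≤1 (s , t) = ≤-trans s (≤-trans (+-monoʳ-≤ y d≤1) (≤-reflexive (+-comm y 1)))
                              , ≤-trans t (≤-trans (+-monoʳ-≤ x d≤1) (≤-reflexive (+-comm x 1)))
        in-block with g-step r
        ... | inj₁ e = slack (f (r + q * K)) (f (suc r + q * K)) z≤n
                         (f-lip q r (suc r) 0 r<K (<⇒≤ r<K) (trans e (sym (+-identityʳ _))))
        ... | inj₂ e = slack (f (r + q * K)) (f (suc r + q * K)) ≤-refl
                         (f-lip q r (suc r) 1 r<K (<⇒≤ r<K) (trans e (+-comm 1 _)))

      lip : ∀ {a b x} → Chord (suc L) a b x → ¬ (a ≡ u * K × b ≡ v * K) → f a ≤ f b + x × f b ≤ f a + x
      -- Along `g` the ends of a short chord are exactly `p` apart, which is its weight.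
      lip (bottom q j j<m refl) _ = subst (λ b → f (j + q * K) ≤ f b + p × f b ≤ f (j + q * K) + p) (+-assoc m j (q * K))
        (f-lip q j (m + j) p (+-monoʳ-≤ m (<⇒≤ j<m)) (≤-trans (<⇒≤ j<m) (m≤m+n m m))
          (trans (g-high j) (trans (+-comm p j) (cong (_+ p) (sym (g-low j<m))))))
      lip (up {a = a} {b} {w} c) ne rewrite f-mul a | f-mul b = scale (proj₁ below) , scale (proj₂ below)
        where
        below = P.lip c (λ { (refl , refl) → ne (refl , refl) })
        scale : ∀ {x y} → x ≤ y + w → x * G ≤ y * G + G * w
        scale {x} {y} le = ≤-trans (*-monoˡ-≤ G le) (≤-reflexive (trans (*-distribʳ-+ G y w) (cong (y * G +_) (*-comm w G))))

      potential : Potential (suc L) (u * K) (v * K) (G * w)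
      potential = record
        { f = f ; step↑ = proj₂ ∘ step ; step↓ = proj₁ ∘ step ; lip = lip
        ; at-u = trans (f-mul u) (cong (_* G) P.at-u)
        ; at-v = begin
            p * f (v * K)      ≡⟨ cong (p *_) (f-mul v) ⟩
            p * (P.f v * G)    ≡⟨ *-assoc p (P.f v) G ⟨
            p * P.f v * G      ≡⟨ cong (_* G) P.at-v ⟩
            m * w * G          ≡⟨ *-assoc m w G ⟩
            m * (w * G)        ≡⟨ cong (m *_) (*-comm w G) ⟩
            m * (G * w)        ∎ }
        where open ≡-Reasoning

    potential : ∀ {L u v w} → Chord L u v w → Potential L u v w
    potential (bottom {a = a} _ _ _ _) = Bottom.potential a
    potential (up c) = Up.potential (potential c)

    -- Total weight of the chords

    aligned short : ℕ → ℕ → Bool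
    aligned a b = (a % K ≡ᵇ 0) ∧ (b % K ≡ᵇ 0)
    short a b = (b ≡ᵇ m + a) ∧ (a % K <ᵇ m)

    -- Weight of the level-L chord from a to b; 0 means that there is none.
    ω : ℕ → ℕ → ℕ → ℕ
    ω zero a b = 0
    ω (suc L) a b = if aligned a b then G * ω L (a / K) (b / K) else (if short a b then p else 0)

    aligned-inv : ∀ a b → aligned a b ≡ true → a ≡ a / K * K × b ≡ b / K * K
    aligned-inv a b e with a % K ≡ᵇ 0 in e₁ | b % K ≡ᵇ 0 in e₂
    ... | true | true = multiple a e₁ , multiple b e₂
      where
      multiple : ∀ x → (x % K ≡ᵇ 0) ≡ true → x ≡ x / K * K
      multiple x e = trans (m≡m%n+[m/n]*n x K) (cong (_+ x / K * K) (≡ᵇ⇒≡ (x % K) 0 (subst T (sym e) _)))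

    short-inv : ∀ a b → short a b ≡ true → b ≡ m + a × a % K < m
    short-inv a b e with b ≡ᵇ m + a in e₁ | a % K <ᵇ m in e₂
    ... | true | true = ≡ᵇ⇒≡ b (m + a) (subst T (sym e₁) _) , <ᵇ⇒< (a % K) m (subst T (sym e₂) _)

    ω-chord : ∀ L a b → ω L a b ≢ 0 → Chord L a b (ω L a b)
    ω-chord zero a b ω≢0 = ⊥-elim (ω≢0 refl)
    ω-chord (suc L) a b ω≢0 with aligned a b in e₁ | short a b in e₂
    ... | true | _ = subst₂ (λ x y → Chord (suc L) x y (G * ω L (a / K) (b / K)))
            (sym (proj₁ (aligned-inv a b e₁))) (sym (proj₂ (aligned-inv a b e₁)))
            (up (ω-chord L (a / K) (b / K) (λ z → ω≢0 (trans (cong (G *_) z) (*-zeroʳ G)))))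
    ... | false | true = subst (λ y → Chord (suc L) a y p) (sym (proj₁ (short-inv a b e₂)))
            (bottom (a / K) (a % K) (proj₂ (short-inv a b e₂)) (m≡m%n+[m/n]*n a K))
    ... | false | false = ⊥-elim (ω≢0 refl)

    aligned-mul : ∀ a b → aligned (a * K) (b * K) ≡ true
    aligned-mul a b = cong₂ (λ x y → (x ≡ᵇ 0) ∧ (y ≡ᵇ 0)) (m*n%n≡0 a K) (m*n%n≡0 b K)

    ω-aligned : ∀ L a b → ω (suc L) (a * K) (b * K) ≡ G * ω L a b
    ω-aligned L a b rewrite aligned-mul a b = cong₂ (λ x y → G * ω L x y) (m*n/n≡m a K) (m*n/n≡m b K)

    -- The right end has residue `m + j`, strictly between 0 and K, so a short chord never occupies
    -- a pair that belongs to a coarser level.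
    ω-short : ∀ L q {j} → j < m → ω (suc L) (j + q * K) (m + (j + q * K)) ≡ p
                                × aligned (j + q * K) (m + (j + q * K)) ≡ false
    ω-short L q {j} j<m = value , not-aligned
      where
      a = j + q * K
      mod-a : a % K ≡ j
      mod-a = block-% q (<-trans j<m m<K)
      mod-b : (m + a) % K ≡ m + j
      mod-b = trans (cong (_% K) (sym (+-assoc m j (q * K)))) (block-% q (+-monoʳ-< m j<m))
      not-aligned : aligned a (m + a) ≡ false
      not-aligned = trans (cong (λ y → (a % K ≡ᵇ 0) ∧ (y ≡ᵇ 0)) mod-b) (𝔹.∧-zeroʳ _)
      is-short : short a (m + a) ≡ true
      is-short = cong₂ _∧_ (≡ᵇ-refl (m + a)) (trans (cong (_<ᵇ m) mod-a) (<ᵇ-true j<m))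
      value : ω (suc L) a (m + a) ≡ p
      value = trans (cong (λ t → if t then G * ω L (a / K) ((m + a) / K) else (if short a (m + a) then p else 0)) not-aligned)
                    (cong (λ t → if t then p else 0) is-short)

    ω-pos⇒< : ∀ L a b → ω L a b ≢ 0 → suc a < b
    ω-pos⇒< L a b = chord-long ∘ ω-chord L a b

    S : ℕ → ℕ → ℕ
    S L n = Σ< n λ a → Σ< n λ b → ω L a b

    -- The sum of `G ^ i * K ^ (L - 1 - i)` over i < L. Term i stands for the level whose lengths
    -- have been scaled i times, and the unit is `m * p`, the weight of the chords of one finest
    -- block.
    V : ℕ → ℕ
    V zero = 0
    V (suc L) = K ^ L + G * V L

    -- Pairs of multiples of K carry the old chords with weights multiplied by `G`; the other pairs
    -- carry the new ones, m of weight `p` in each of the X blocks.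
    S-step : ∀ L X → X * (m * p) + G * S L X ≤ S (suc L) (X * K)
    S-step L X = begin
      X * (m * p) + G * S L X
        ≤⟨ +-mono-≤ short-part (≤-reflexive aligned-part) ⟩
      (Σ< (X * K) λ a → Σ< (X * K) λ b → v a b) + (Σ< X λ a → Σ< X λ b → u (a * K) (b * K))
        ≤⟨ +-monoʳ-≤ _ (≤-trans (sum-mono {X} λ a → Σ<-multiples X (u (toℕ a * K))) (Σ<-multiples X λ a → Σ< (X * K) (u a))) ⟩
      (Σ< (X * K) λ a → Σ< (X * K) λ b → v a b) + (Σ< (X * K) λ a → Σ< (X * K) λ b → u a b)
        ≡⟨ trans (sym (∑-distrib-+ {X * K} _ _)) (sum-cong-≗ {X * K} λ a → sym (∑-distrib-+ {X * K} _ _)) ⟩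
      (Σ< (X * K) λ a → Σ< (X * K) λ b → v a b + u a b)
        ≡⟨ (sum-cong-≗ {X * K} λ a → sum-cong-≗ {X * K} λ b → split (toℕ a) (toℕ b)) ⟩
      S (suc L) (X * K) ∎
      where
      open ≤-Reasoning
      u v : ℕ → ℕ → ℕ
      u a b = if aligned a b then ω (suc L) a b else 0
      v a b = if aligned a b then 0 else ω (suc L) a b
      split : ∀ a b → v a b + u a b ≡ ω (suc L) a b
      split a b with aligned a b
      ... | true = refl
      ... | false = +-identityʳ _
      Σ<-multiples : ∀ X f → (Σ< X λ q → f (q * K)) ≤ Σ< (X * K) f
      Σ<-multiples X f = ≤-trans (sum-mono {X} λ q → sum-≥-term (λ (r : Fin K) → f (toℕ r + toℕ q * K)) Fin.zero)
                                 (≤-reflexive (sym (Σ<-blocks X K f)))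
      u-mul : ∀ a b → u (a * K) (b * K) ≡ G * ω L a b
      u-mul a b = trans (cong (λ t → if t then ω (suc L) (a * K) (b * K) else 0) (aligned-mul a b)) (ω-aligned L a b)
      aligned-part : G * S L X ≡ Σ< X λ a → Σ< X λ b → u (a * K) (b * K)
      aligned-part = trans (*-distribˡ-sum {X} G _) (sum-cong-≗ {X} λ a →
                       trans (*-distribˡ-sum {X} G _) (sum-cong-≗ {X} λ b → sym (u-mul (toℕ a) (toℕ b))))
      v-row : ∀ (q : Fin X) {j} → j < m → p ≤ Σ< (X * K) (v (j + toℕ q * K))
      v-row q {j} j<m = subst (_≤ Σ< (X * K) (v a)) v-value (Σ<-≥-term (X * K) (v a) in-range)
        where
        a = j + toℕ q * K
        in-range : m + a < X * K
        in-range = begin-strict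
          m + (j + toℕ q * K)  ≡⟨ +-assoc m j _ ⟨
          m + j + toℕ q * K    <⟨ +-monoˡ-< _ (+-monoʳ-< m j<m) ⟩
          suc (toℕ q) * K      ≤⟨ *-monoˡ-≤ K (Fin.toℕ<n q) ⟩
          X * K                ∎
        v-value : v a (m + a) ≡ p
        v-value = trans (cong (λ t → if t then 0 else ω (suc L) a (m + a)) (proj₂ (ω-short L (toℕ q) j<m)))
                        (proj₁ (ω-short L (toℕ q) j<m))
      short-part : X * (m * p) ≤ Σ< (X * K) λ a → Σ< (X * K) (v a)
      short-part = begin
        X * (m * p)
          ≡⟨ sum-const X (m * p) ⟨
        sum {X} (λ _ → m * p)
          ≤⟨ (sum-mono {X} λ q → ≤-trans (≤-reflexive (sym (sum-const m p)))
               (≤-trans (sum-mono {m} λ j → v-row q (Fin.toℕ<n j)) (Σ<-≤ m m λ r → Σ< (X * K) (v (r + toℕ q * K))))) ⟩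
        (Σ< X λ q → Σ< K λ r → Σ< (X * K) (v (r + q * K)))
          ≡⟨ Σ<-blocks X K (λ a → Σ< (X * K) (v a)) ⟨
        (Σ< (X * K) λ a → Σ< (X * K) (v a)) ∎

    S-lower : ∀ L N → N * (m * p) * V L ≤ S L (N * K ^ L)
    S-lower zero N = ≤-trans (≤-reflexive (*-zeroʳ (N * (m * p)))) z≤n
    S-lower (suc L) N = begin
      N * (m * p) * (K ^ L + G * V L)
        ≡⟨ ring N (m * p) (K ^ L) G (V L) ⟩
      N * K ^ L * (m * p) + G * (N * (m * p) * V L)
        ≤⟨ +-monoʳ-≤ (N * K ^ L * (m * p)) (*-monoʳ-≤ G (S-lower L N)) ⟩
      N * K ^ L * (m * p) + G * S L (N * K ^ L)
        ≤⟨ S-step L (N * K ^ L) ⟩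
      S (suc L) (N * K ^ L * K)
        ≡⟨ cong (S (suc L)) (trans (*-assoc N (K ^ L) K) (cong (N *_) (*-comm (K ^ L) K))) ⟩
      S (suc L) (N * K ^ suc L) ∎
      where
      open ≤-Reasoning
      ring : ∀ N x k g v → N * x * (k + g * v) ≡ N * k * x + g * (N * x * v)
      ring = solve-∀

    -- Summand i of `V L` is `K ^ (L - 1)` times `(1 - 1/K)^i`, a factor of at least `1 - i/K`; for
    -- L ≤ K these factors average at least 1/2. The induction is this Bernoulli estimate without
    -- fractions.
    V-lower : ∀ L → L ≤ K → L * K ^ L ≤ 2 * K * V L
    V-lower zero _ = z≤n
    V-lower (suc L) L<K = begin
      suc L * (K * k)                       ≡⟨ ring₁ L G k ⟩
      G * (L * k) + (L * k + suc G * k)     ≤⟨ +-mono-≤ (*-monoʳ-≤ G (V-lower L (<⇒≤ L<K))) (+-monoˡ-≤ _ (*-monoˡ-≤ k (<⇒≤ L<K))) ⟩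
      G * (2 * K * V L) + (K * k + K * k)   ≡⟨ ring₂ G k (V L) ⟩
      2 * K * (k + G * V L)                 ∎
      where
      open ≤-Reasoning
      k = K ^ L
      ring₁ : ∀ L G k → suc L * (suc G * k) ≡ G * (L * k) + (L * k + suc G * k)
      ring₁ = solve-∀
      ring₂ : ∀ G k v → G * (2 * suc G * v) + (suc G * k + suc G * k) ≡ 2 * suc G * (k + G * v)
      ring₂ = solve-∀

    S-mono : ∀ L {n n′} → n ≤ n′ → S L n ≤ S L n′
    S-mono L {n} {n′} le = subst (λ x → S L n ≤ S L x) (m+[n∸m]≡n le)
      (≤-trans (sum-mono {n} λ a → Σ<-≤ n (n′ ∸ n) (ω L (toℕ a))) (Σ<-≤ n (n′ ∸ n) λ a → Σ< (n + (n′ ∸ n)) (ω L a)))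

    -- With L = m and K = 2m the bound `V-lower` amounts to `K ^ m ≤ 4 * V m`: a factor 2 for the
    -- decay over the levels, a factor 2 for m being half of K.
    chords-heavy : ∀ N n → N * K ^ m ≤ n → N * K ^ m * (m * p) ≤ 4 * S m n
    chords-heavy N n le = *-cancelˡ-≤ K (begin
      K * (N * K ^ m * (m * p))              ≡⟨ ring₁ m N (K ^ m) (m * p) ⟩
      2 * (N * (m * p) * (m * K ^ m))        ≤⟨ *-monoʳ-≤ 2 (*-monoʳ-≤ (N * (m * p)) (V-lower m (m≤m+n m m))) ⟩
      2 * (N * (m * p) * (2 * K * V m))      ≡⟨ ring₂ K (N * (m * p)) (V m) ⟩
      K * (4 * (N * (m * p) * V m))          ≤⟨ *-monoʳ-≤ K (*-monoʳ-≤ 4 (≤-trans (S-lower m N) (S-mono m le))) ⟩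
      K * (4 * S m n)                        ∎)
      where
      open ≤-Reasoning
      ring₁ : ∀ m N k x → (m + m) * (N * k * x) ≡ 2 * (N * x * (m * k))
      ring₁ = solve-∀
      ring₂ : ∀ K y v → 2 * (y * (2 * K * v)) ≡ K * (4 * (y * v))
      ring₂ = solve-∀

  -- Tree decomposition

  module Elimination (h : ℕ) where
    open Chords h

    -- Positions in a block: `o` is the left end, `mid` the end shared by the halves, `X i` and
    -- `Y i` are the inner vertices of the first and the second half. The short chords are the rungs
    -- from `X i` to `Y i` and the one from `o` to `mid`.
    data Digit : Set where
      o mid : Digit
      X Y   : ℕ → Digit

    val : Digit → ℕ
    val o     = 0
    val mid   = m
    val (X i) = suc i
    val (Y i) = suc (i + m)

    Valid : Digit → Set
    Valid o     = ⊤
    Valid mid   = ⊤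
    Valid (X i) = i < p
    Valid (Y i) = i < p

    digit : ℕ → Digit
    digit zero = o
    digit (suc i) with <-cmp i p
    ... | tri< _ _ _ = X i
    ... | tri≈ _ _ _ = mid
    ... | tri> _ _ _ = Y (i ∸ m)

    val<K : ∀ d → Valid d → val d < K
    val<K o _ = s≤s z≤n
    val<K mid _ = m<K
    val<K (X i) i<p = s≤s (≤-trans i<p (m≤m+n p m))
    val<K (Y i) i<p = s≤s (+-monoˡ-< m i<p)

    digit-val : ∀ d → Valid d → digit (val d) ≡ d
    digit-val o _ = refl
    digit-val mid _ with <-cmp p p
    ... | tri< a _ _ = ⊥-elim (<-irrefl refl a)
    ... | tri≈ _ _ _ = refl
    ... | tri> _ _ a = ⊥-elim (<-irrefl refl a)
    digit-val (X i) i<p with <-cmp i p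
    ... | tri< _ _ _ = refl
    ... | tri≈ a _ _ = ⊥-elim (a i<p)
    ... | tri> a _ _ = ⊥-elim (a i<p)
    digit-val (Y i) i<p with <-cmp (i + m) p
    ... | tri< _ _ c = ⊥-elim (c (m≤n+m m i))
    ... | tri≈ _ _ c = ⊥-elim (c (m≤n+m m i))
    ... | tri> _ _ _ = cong Y (m+n∸n≡m i m)

    val-digit : ∀ r → r < K → Valid (digit r) × val (digit r) ≡ r
    val-digit zero _ = tt , refl
    val-digit (suc i) i<K with <-cmp i p
    ... | tri< i<p _ _ = i<p , refl
    ... | tri≈ _ refl _ = tt , refl
    ... | tri> _ _ m≤i = +-cancelʳ-< m (i ∸ m) p (subst (_< p + m) (sym e) (s≤s⁻¹ i<K)) , cong suc e
      where
      e : i ∸ m + m ≡ i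
      e = m∸n+n≡m m≤i

    enc : ℕ → Digit → ℕ
    enc q d = val d + q * K

    data View : ℕ → Set where
      at : ∀ q d → Valid d → View (enc q d)

    view : ∀ a → View a
    view a with val-digit (a % K) (m%n<n a K)
    ... | v , e = subst View (trans (cong (_+ a / K * K) e) (sym (m≡m%n+[m/n]*n a K))) (at (a / K) (digit (a % K)) v)

    byDigit : ∀ {A : Set} → (ℕ → Digit → A) → ℕ → A
    byDigit F a = F (a / K) (digit (a % K))

    byDigit-enc : ∀ {A : Set} (F : ℕ → Digit → A) q d → Valid d → byDigit F (enc q d) ≡ F q d
    byDigit-enc F q d v = cong₂ F (block-/ q (val<K d v)) (trans (cong digit (block-% q (val<K d v))) (digit-val d v))

    previousX previousY : ℕ → Digit
    previousX zero    = o
    previousX (suc i) = X i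
    previousY zero    = mid
    previousY (suc i) = Y i

    -- The last inner vertex of a half has no successor of the same kind; its right neighbour, `mid`
    -- or the right end of the block, is already in its own bag.
    owner : Digit → Digit
    owner o     = X 0
    owner mid   = Y 0
    owner (X i) = if suc i <ᵇ p then X (suc i) else X i
    owner (Y i) = if suc i <ᵇ p then Y (suc i) else Y i

    -- own L a is whichever of a and a + 1 has both in its bag.
    own : ℕ → ℕ → ℕ
    own zero    = suc
    own (suc L) = byDigit λ q d → enc q (owner d)

    -- Inside a block the vertices are introduced in the order mid, X 0, Y 0, X 1, Y 1, …
    bagAt : (ℕ → List ℕ) → ℕ → Digit → List ℕ
    bagAt B q o     = map (_* K) (B q)
    bagAt B q mid   = enc q mid ∷ enc q o ∷ enc (suc q) o ∷ []
    bagAt B q (X i) = enc q (X i) ∷ enc q (previousX i) ∷ enc q (previousY i) ∷ enc q mid ∷ enc (suc q) o ∷ []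
    bagAt B q (Y i) = enc q (Y i) ∷ enc q (X i) ∷ enc q (previousY i) ∷ enc q mid ∷ enc (suc q) o ∷ []

    bags : ℕ → ℕ → List ℕ
    bags zero a  = a ∷ pred a ∷ []
    bags (suc L) = byDigit (bagAt (bags L))

    -- The parent has to contain the rest of the bag. For `mid` this is the pair of block ends,
    -- which are consecutive on the coarser level and therefore meet in the bag of `own L q`.
    parentAt : ℕ → (ℕ → ℕ) → ℕ → Digit → ℕ
    parentAt L P q o     = enc (P q) o
    parentAt L P q mid   = enc (own L q) o
    parentAt L P q (X i) = enc q (previousY i)
    parentAt L P q (Y i) = enc q (X i)

    parent : ℕ → ℕ → ℕ
    parent zero    = pred
    parent (suc L) = byDigit (parentAt L (parent L))

    -- Follows the order in which a block introduces its vertices, counted on from the node where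
    -- the block is attached.
    rankAt : ℕ → (ℕ → ℕ) → ℕ → Digit → ℕ
    rankAt L ρ q o     = ρ q
    rankAt L ρ q mid   = 1 + ρ (own L q)
    rankAt L ρ q (X i) = 2 + (i + i + ρ (own L q))
    rankAt L ρ q (Y i) = 3 + (i + i + ρ (own L q))

    rank : ℕ → ℕ → ℕ
    rank zero a  = a
    rank (suc L) = byDigit (rankAt L (rank L))

    previousY-valid : ∀ i → i < p → Valid (previousY i)
    previousY-valid zero _ = tt
    previousY-valid (suc i) i<p = <-trans ≤-refl i<p

    bags-enc : ∀ L {x} q d → Valid d → x ∈ bagAt (bags L) q d → x ∈ bags (suc L) (enc q d)
    bags-enc L {x} q d v = subst (x ∈_) (sym (byDigit-enc (bagAt (bags L)) q d v))

    bags-length : ∀ L a → length (bags L a) ≤ 5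
    bags-length zero a = s≤s (s≤s z≤n)
    bags-length (suc L) a with view a
    ... | at q d v rewrite byDigit-enc (bagAt (bags L)) q d v = at-digit d
      where
      at-digit : ∀ d → length (bagAt (bags L) q d) ≤ 5
      at-digit o rewrite length-map (_* K) (bags L q) = bags-length L q
      at-digit mid = s≤s (s≤s (s≤s z≤n))
      at-digit (X i) = ≤-refl
      at-digit (Y i) = ≤-refl

    bags-self : ∀ L a → a ∈ bags L a
    bags-self zero a = here refl
    bags-self (suc L) a with view a
    ... | at q d v = bags-enc L q d v (at-digit d)
      where
      at-digit : ∀ d → enc q d ∈ bagAt (bags L) q d
      at-digit o = ∈-map⁺ (_* K) (bags-self L q)
      at-digit mid = here refl
      at-digit (X i) = here refl
      at-digit (Y i) = here refl

    -- Vertex 0 is alone in the bag of the root, so the upward walk of any other vertex ends at its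
    -- own node before reaching the root.
    bags-root : ∀ L {x} → x ∈ bags L 0 → x ≡ 0
    bags-root zero (here e) = e
    bags-root zero (there (here e)) = e
    bags-root (suc L) x∈ with ∈-map⁻ (_* K) x∈
    ... | y , y∈ , refl rewrite bags-root L y∈ = refl

    private
      last : ∀ i → i < p → (suc i <ᵇ p) ≡ false → suc i ≡ p
      last i i<p e with m≤n⇒m<n∨m≡n i<p
      ... | inj₂ e′ = e′
      ... | inj₁ si<p with trans (sym e) (<ᵇ-true si<p)
      ...   | ()

    -- Needed twice: on the finest level consecutive vertices are path edges to be covered, and on
    -- coarser levels they are the ends of a block that is to be hung into the tree.
    bags-own : ∀ L a → a ∈ bags L (own L a) × suc a ∈ bags L (own L a)
    bags-own zero a = there (here refl) , here refl
    bags-own (suc L) a with view a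
    ... | at q d v rewrite byDigit-enc (λ q d → enc q (owner d)) q d v = at-digit d v
      where
      at-digit : ∀ d → Valid d → enc q d ∈ bags (suc L) (enc q (owner d)) × suc (enc q d) ∈ bags (suc L) (enc q (owner d))
      at-digit o _ = bags-enc L q (X 0) (s≤s z≤n) (there (here refl)) , bags-enc L q (X 0) (s≤s z≤n) (here refl)
      at-digit mid _ = bags-enc L q (Y 0) (s≤s z≤n) (there (there (here refl))) , bags-enc L q (Y 0) (s≤s z≤n) (here refl)
      at-digit (X i) v with suc i <ᵇ p in e
      ... | true = bags-enc L q (X (suc i)) v′ (there (here refl)) , bags-enc L q (X (suc i)) v′ (here refl)
        where v′ = <ᵇ⇒< (suc i) p (subst T (sym e) tt)
      ... | false = bags-enc L q (X i) v (here refl)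
                  , bags-enc L q (X i) v (there (there (there (here (cong (λ x → suc x + q * K) (last i v e))))))
      at-digit (Y i) v with suc i <ᵇ p in e
      ... | true = bags-enc L q (Y (suc i)) v′ (there (there (here refl))) , bags-enc L q (Y (suc i)) v′ (here refl)
        where v′ = <ᵇ⇒< (suc i) p (subst T (sym e) tt)
      ... | false = bags-enc L q (Y i) v (here refl)
                  , bags-enc L q (Y i) v (there (there (there (there (here (cong (λ x → suc (x + m) + q * K) (last i v e)))))))

    own-bound : ∀ L a → own L a ≤ suc a
    own-bound zero a = ≤-refl
    own-bound (suc L) a with view a
    ... | at q d v rewrite byDigit-enc (λ q d → enc q (owner d)) q d v = +-monoˡ-≤ (q * K) (at-digit d)
      where
      at-digit : ∀ d → val (owner d) ≤ suc (val d)
      at-digit o = ≤-refl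
      at-digit mid = ≤-refl
      at-digit (X i) with suc i <ᵇ p
      ... | true = ≤-refl
      ... | false = n≤1+n _
      at-digit (Y i) with suc i <ᵇ p
      ... | true = ≤-refl
      ... | false = n≤1+n _

    -- The elimination property: on the way up a vertex is lost only at its own node. The bags that
    -- contain it therefore form a connected subtree.
    bags-parent : ∀ L a {x} → x ∈ bags L a → x ≢ a → x ∈ bags L (parent L a)
    bags-parent zero a (here e) x≢a = ⊥-elim (x≢a e)
    bags-parent zero a (there (here e)) x≢a = here e
    bags-parent (suc L) a {x} x∈ x≢a with view a
    ... | at q d v rewrite byDigit-enc (bagAt (bags L)) q d v | byDigit-enc (parentAt L (parent L)) q d v = at-digit d v x∈ x≢a
      where
      above-X : ∀ i → i < p → ∀ {x} → x ∈ enc q (previousX i) ∷ enc q (previousY i) ∷ enc q mid ∷ enc (suc q) o ∷ [] →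
        x ∈ bagAt (bags L) q (previousY i)
      above-X zero _ (here e) = there (here e)
      above-X zero _ (there (here e)) = here e
      above-X zero _ (there (there (here e))) = here e
      above-X zero _ (there (there (there (here e)))) = there (there (here e))
      above-X (suc i) _ (here e) = there (here e)
      above-X (suc i) _ (there (here e)) = here e
      above-X (suc i) _ (there (there (here e))) = there (there (there (here e)))
      above-X (suc i) _ (there (there (there (here e)))) = there (there (there (there (here e))))

      at-digit : ∀ d → Valid d → ∀ {x} → x ∈ bagAt (bags L) q d → x ≢ enc q d → x ∈ bags (suc L) (parentAt L (parent L) q d)
      at-digit o _ x∈ ne with ∈-map⁻ (_* K) x∈
      ... | y , y∈ , refl = bags-enc L (parent L q) o tt (∈-map⁺ (_* K) (bags-parent L q y∈ (ne ∘ cong (_* K))))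
      at-digit mid _ (here e) ne = ⊥-elim (ne e)
      at-digit mid _ (there (here refl)) ne = bags-enc L (own L q) o tt (∈-map⁺ (_* K) (proj₁ (bags-own L q)))
      at-digit mid _ (there (there (here refl))) ne = bags-enc L (own L q) o tt (∈-map⁺ (_* K) (proj₂ (bags-own L q)))
      at-digit (X i) v (here e) ne = ⊥-elim (ne e)
      at-digit (X i) v (there x∈) ne = bags-enc L q (previousY i) (previousY-valid i v) (above-X i v x∈)
      at-digit (Y i) v (here e) ne = ⊥-elim (ne e)
      at-digit (Y i) v (there (here e)) ne = bags-enc L q (X i) v (here e)
      at-digit (Y i) v (there (there x∈)) ne = bags-enc L q (X i) v (there (there x∈))

    rank-parent : ∀ L a → a ≢ 0 → rank L (parent L a) < rank L a
    rank-parent zero zero a≢0 = ⊥-elim (a≢0 refl)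
    rank-parent zero (suc a) _ = ≤-refl
    rank-parent (suc L) a a≢0 with view a
    ... | at q d v rewrite byDigit-enc (rankAt L (rank L)) q d v | byDigit-enc (parentAt L (parent L)) q d v = at-digit d v a≢0
      where
      rank-enc : ∀ q d → Valid d → rank (suc L) (enc q d) ≡ rankAt L (rank L) q d
      rank-enc = byDigit-enc (rankAt L (rank L))
      at-digit : ∀ d → Valid d → enc q d ≢ 0 → rank (suc L) (parentAt L (parent L) q d) < rankAt L (rank L) q d
      at-digit o _ ne rewrite rank-enc (parent L q) o tt = rank-parent L q (λ { refl → ne refl })
      at-digit mid _ _ rewrite rank-enc (own L q) o tt = ≤-refl
      at-digit (X zero) v _ rewrite rank-enc q mid tt = ≤-refl
      at-digit (X (suc i)) v _ rewrite rank-enc q (Y i) (<-trans ≤-refl v) | +-suc i i = ≤-refl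
      at-digit (Y i) v _ rewrite rank-enc q (X i) v = ≤-refl

    -- A parent can lie to the right of its child, since `mid` may hang below the right end of its
    -- block. It never lies beyond that right end, so a multiple of `K ^ L` is a safe bound.
    parent-bound : ∀ L N a → a ≤ N * K ^ L → parent L a ≤ N * K ^ L
    parent-bound zero N a a≤ = ≤-trans pred[n]≤n a≤
    parent-bound (suc L) N a a≤ = subst (parent (suc L) a ≤_) (sym e) (bound a (subst (a ≤_) e a≤))
      where
      M = N * K ^ L
      e : N * K ^ suc L ≡ M * K
      e = trans (cong (N *_) (*-comm K (K ^ L))) (sym (*-assoc N (K ^ L) K))
      bound : ∀ a → a ≤ M * K → parent (suc L) a ≤ M * K
      bound a a≤ with view a
      ... | at q d v rewrite byDigit-enc (parentAt L (parent L)) q d v = at-digit d v a≤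
        where
        q<M : ∀ {x} → suc x + q * K ≤ M * K → q < M
        q<M {x} le = *-cancelʳ-< K q M (≤-trans (s≤s (m≤n+m (q * K) x)) le)
        inside : ∀ d → Valid d → q < M → enc q d ≤ M * K
        inside d v q<M = ≤-trans (+-monoˡ-≤ (q * K) (<⇒≤ (val<K d v))) (*-monoˡ-≤ K q<M)
        at-digit : ∀ d → Valid d → enc q d ≤ M * K → parentAt L (parent L) q d ≤ M * K
        at-digit o _ le = *-monoˡ-≤ K (parent-bound L N q (*-cancelʳ-≤ q M K le))
        at-digit mid _ le = *-monoˡ-≤ K (≤-trans (own-bound L q) (q<M le))
        at-digit (X i) v le = inside (previousY i) (previousY-valid i v) (q<M le)
        at-digit (Y i) v le = inside (X i) v (q<M le)

    bags-chord : ∀ {L a b w} → Chord L a b w → a ∈ bags L b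
    bags-chord {suc L} (bottom q zero _ refl) = bags-enc L q mid tt (there (here refl))
    bags-chord {suc L} (bottom q (suc i) i<p refl) =
      subst (λ b → enc q (X i) ∈ bags (suc L) b) e (bags-enc L q (Y i) (s≤s⁻¹ i<p) (there (here refl)))
      where
      e : enc q (Y i) ≡ m + enc q (X i)
      e = trans (cong (_+ q * K) (+-comm (suc i) m)) (+-assoc m (suc i) (q * K))
    bags-chord {suc L} (up {b = b} c) = bags-enc L b o tt (∈-map⁺ (_* K) (bags-chord c))

  -- Rational arithmetic

  -- The definition passes through a normalisation by a gcd, which does not compute for a variable
  -- k; in this form numerator and denominator are visible.
  ℕ→ℚ-mk : ∀ k → ℕ→ℚ k ≡ mkℚ (ℤ.+ k) 0 (Coprime.sym (Coprime.1-coprimeTo k))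
  ℕ→ℚ-mk k = ℚ.normalize-coprime (Coprime.sym (Coprime.1-coprimeTo k))

  toℚᵘ-ℕ→ℚ : ∀ k → ℚ.toℚᵘ (ℕ→ℚ k) ≡ ℚᵘ.mkℚᵘ (ℤ.+ k) 0
  toℚᵘ-ℕ→ℚ k = cong ℚ.toℚᵘ (ℕ→ℚ-mk k)

  ℕ→ℚ-+ : ∀ a b → ℕ→ℚ (a + b) ≡ ℕ→ℚ a ℚ.+ ℕ→ℚ b
  ℕ→ℚ-+ a b = ℚ.toℚᵘ-injective (ℚᵘ.≃-trans same (ℚᵘ.≃-sym (ℚ.toℚᵘ-homo-+ (ℕ→ℚ a) (ℕ→ℚ b))))
    where
    same : ℚ.toℚᵘ (ℕ→ℚ (a + b)) ℚᵘ.≃ ℚ.toℚᵘ (ℕ→ℚ a) ℚᵘ.+ ℚ.toℚᵘ (ℕ→ℚ b)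
    same rewrite toℚᵘ-ℕ→ℚ (a + b) | toℚᵘ-ℕ→ℚ a | toℚᵘ-ℕ→ℚ b =
      ℚᵘ.*≡* (cong (ℤ._* ℤ.+ 1) (trans (ℤ.pos-+ a b) (sym (cong₂ ℤ._+_ (ℤ.*-identityʳ (ℤ.+ a)) (ℤ.*-identityʳ (ℤ.+ b))))))

  ℕ→ℚ-* : ∀ a b → ℕ→ℚ (a * b) ≡ ℕ→ℚ a ℚ.* ℕ→ℚ b
  ℕ→ℚ-* a b = ℚ.toℚᵘ-injective (ℚᵘ.≃-trans same (ℚᵘ.≃-sym (ℚ.toℚᵘ-homo-* (ℕ→ℚ a) (ℕ→ℚ b))))
    where
    same : ℚ.toℚᵘ (ℕ→ℚ (a * b)) ℚᵘ.≃ ℚ.toℚᵘ (ℕ→ℚ a) ℚᵘ.* ℚ.toℚᵘ (ℕ→ℚ b)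
    same rewrite toℚᵘ-ℕ→ℚ (a * b) | toℚᵘ-ℕ→ℚ a | toℚᵘ-ℕ→ℚ b = ℚᵘ.*≡* (cong (ℤ._* ℤ.+ 1) (ℤ.pos-* a b))

  ℕ→ℚ-mono : ∀ a b → a ≤ b → ℕ→ℚ a ℚ.≤ ℕ→ℚ b
  ℕ→ℚ-mono a b a≤b rewrite ℕ→ℚ-mk a | ℕ→ℚ-mk b = ℚ.*≤* (ℤ.*-monoʳ-≤-nonNeg (ℤ.+ 1) (ℤ.+≤+ a≤b))

  ℕ→ℚ-cancel : ∀ a b → ℕ→ℚ a ℚ.≤ ℕ→ℚ b → a ≤ b
  ℕ→ℚ-cancel a b le rewrite ℕ→ℚ-mk a | ℕ→ℚ-mk b with le
  ... | ℚ.*≤* le′ = ℤ.drop‿+≤+ (ℤ.*-cancelʳ-≤-pos (ℤ.+ a) (ℤ.+ b) (ℤ.+ 1) le′)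

  ℕ→ℚ-≥0 : ∀ k → 0ℚ ℚ.≤ ℕ→ℚ k
  ℕ→ℚ-≥0 k = ℕ→ℚ-mono 0 k z≤n

  ℕ→ℚ->0 : ∀ k → 0ℚ ℚ.< ℕ→ℚ (suc k)
  ℕ→ℚ->0 k = ℚ.≰⇒> λ le → 1+n≰n (≤-trans (ℕ→ℚ-cancel (suc k) 0 le) z≤n)

  *-monoˡ : ∀ {x y z} → 0ℚ ℚ.≤ z → x ℚ.≤ y → z ℚ.* x ℚ.≤ z ℚ.* y
  *-monoˡ {z = z} 0≤z = ℚ.*-monoˡ-≤-nonNeg z {{ℚ.nonNegative 0≤z}}

  *-monoʳ : ∀ {x y z} → 0ℚ ℚ.≤ z → x ℚ.≤ y → x ℚ.* z ℚ.≤ y ℚ.* z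
  *-monoʳ {z = z} 0≤z = ℚ.*-monoʳ-≤-nonNeg z {{ℚ.nonNegative 0≤z}}

  *-mono : ∀ {w x y z} → 0ℚ ℚ.≤ w → w ℚ.≤ x → 0ℚ ℚ.≤ y → y ℚ.≤ z → w ℚ.* y ℚ.≤ x ℚ.* z
  *-mono 0≤w w≤x 0≤y y≤z = ℚ.≤-trans (*-monoˡ 0≤w y≤z) (*-monoʳ (ℚ.≤-trans 0≤y y≤z) w≤x)

  *-≥0 : ∀ {x y} → 0ℚ ℚ.≤ x → 0ℚ ℚ.≤ y → 0ℚ ℚ.≤ x ℚ.* y
  *-≥0 {x} {y} 0≤x 0≤y = subst (ℚ._≤ x ℚ.* y) (ℚ.*-zeroʳ x) (*-monoˡ 0≤x 0≤y)

  module _ {x : ℚ} (1≤x : 1ℚ ℚ.≤ x) where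

    private
      0≤x : 0ℚ ℚ.≤ x
      0≤x = ℚ.≤-trans (ℕ→ℚ-≥0 1) 1≤x

    ^ℚ-≥1 : ∀ k → 1ℚ ℚ.≤ x ^ℚ k
    ^ℚ-≥1 zero = ℚ.≤-refl
    ^ℚ-≥1 (suc k) = ℚ.≤-trans (ℚ.≤-reflexive (sym (ℚ.*-identityˡ 1ℚ))) (*-mono (ℕ→ℚ-≥0 1) 1≤x (ℕ→ℚ-≥0 1) (^ℚ-≥1 k))

    ^ℚ-mono-exp : ∀ {j k} → j ≤ k → x ^ℚ j ℚ.≤ x ^ℚ k
    ^ℚ-mono-exp {k = k} z≤n = ^ℚ-≥1 k
    ^ℚ-mono-exp (s≤s le) = *-monoˡ 0≤x (^ℚ-mono-exp le)

  ℕ→ℚ-^ : ∀ a {x} → ℕ→ℚ a ℚ.≤ x → ∀ k → ℕ→ℚ (a ^ k) ℚ.≤ x ^ℚ k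
  ℕ→ℚ-^ a a≤x zero = ℚ.≤-refl
  ℕ→ℚ-^ a a≤x (suc k) =
    ℚ.≤-trans (ℚ.≤-reflexive (ℕ→ℚ-* a (a ^ k))) (*-mono (ℕ→ℚ-≥0 a) a≤x (ℕ→ℚ-≥0 (a ^ k)) (ℕ→ℚ-^ a a≤x k))

  -- Meant for x = 1/ε: the strict bound on `p = 1 + h` gives εp < 1, which excludes detours, and
  -- the bound by `m = 2 + h` turns lightness in terms of m into lightness in terms of 1/ε. The
  -- downward search starts at k.
  ceiling : ∀ {x} → 1ℚ ℚ.< x → ∀ k → x ℚ.≤ ℕ→ℚ k → ∃[ h ] (ℕ→ℚ (suc h) ℚ.< x × x ℚ.≤ ℕ→ℚ (2 + h))
  ceiling 1<x zero x≤k = ⊥-elim (ℚ.<-irrefl refl (ℚ.<-≤-trans 1<x (ℚ.≤-trans x≤k (ℕ→ℚ-≥0 1))))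
  ceiling {x} 1<x (suc k) x≤k with x ℚ.≤? ℕ→ℚ k
  ... | yes x≤ = ceiling 1<x k x≤
  ceiling 1<x (suc zero) x≤k | no _ = ⊥-elim (ℚ.<-irrefl refl (ℚ.<-≤-trans 1<x x≤k))
  ceiling 1<x (suc (suc h)) x≤k | no x≰ = h , ℚ.≰⇒> x≰ , x≤k

  -- Multiplied by p, the stretch allows at most (p + εp)w, which is below (p + 1)w.
  no-detour : ∀ ε p → ε ℚ.* ℕ→ℚ p ℚ.< 1ℚ → ∀ w W → 1 ≤ w →
    ℕ→ℚ W ℚ.≤ (1ℚ ℚ.+ ε) ℚ.* ℕ→ℚ w → suc p * w ≤ p * W → ⊥
  no-detour ε p εp<1 w W 1≤w le big = ℚ.<-irrefl refl (begin-strict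
    ℕ→ℚ (suc p * w)                          ≤⟨ ℕ→ℚ-mono (suc p * w) (p * W) big ⟩
    ℕ→ℚ (p * W)                          ≡⟨ ℕ→ℚ-* p W ⟩
    P ℚ.* ℕ→ℚ W                          ≤⟨ *-monoˡ (ℕ→ℚ-≥0 p) le ⟩
    P ℚ.* ((1ℚ ℚ.+ ε) ℚ.* ℕ→ℚ w)         ≡⟨ expand ⟩
    (P ℚ.+ ε ℚ.* P) ℚ.* ℕ→ℚ w            <⟨ ℚ.*-monoˡ-<-pos (ℕ→ℚ w) {{ℚ.positive w>0}} (ℚ.+-monoʳ-< P εp<1) ⟩
    (P ℚ.+ 1ℚ) ℚ.* ℕ→ℚ w                 ≡⟨ cong (ℚ._* ℕ→ℚ w) (trans (sym (ℕ→ℚ-+ p 1)) (cong ℕ→ℚ (+-comm p 1))) ⟩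
    ℕ→ℚ (suc p) ℚ.* ℕ→ℚ w                      ≡⟨ ℕ→ℚ-* (suc p) w ⟨
    ℕ→ℚ (suc p * w)                          ∎)
    where
    open ℚ.≤-Reasoning
    P : ℚ
    P = ℕ→ℚ p
    w>0 : 0ℚ ℚ.< ℕ→ℚ w
    w>0 = ℚ.<-≤-trans (ℕ→ℚ->0 0) (ℕ→ℚ-mono 1 w 1≤w)
    expand : P ℚ.* ((1ℚ ℚ.+ ε) ℚ.* ℕ→ℚ w) ≡ (P ℚ.+ ε ℚ.* P) ℚ.* ℕ→ℚ w
    expand = trans (sym (ℚ.*-assoc P _ _)) (cong (ℚ._* ℕ→ℚ w)
      (trans (ℚ.*-distribˡ-+ P 1ℚ ε) (cong₂ ℚ._+_ (ℚ.*-identityʳ P) (ℚ.*-comm P ε))))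

  -- The network and its spanners

  sumℚ-++ : ∀ {xs ys a b} → sumℚ xs ≡ ℕ→ℚ a → sumℚ ys ≡ ℕ→ℚ b → sumℚ (xs ++ ys) ≡ ℕ→ℚ (a + b)
  sumℚ-++ {xs} {ys} {a} {b} e₁ e₂ = trans (hom xs) (trans (cong₂ ℚ._+_ e₁ e₂) (sym (ℕ→ℚ-+ a b)))
    where
    hom : ∀ xs → sumℚ (xs ++ ys) ≡ sumℚ xs ℚ.+ sumℚ ys
    hom [] = sym (ℚ.+-identityˡ _)
    hom (x ∷ xs) = trans (cong (x ℚ.+_) (hom xs)) (sym (ℚ.+-assoc x _ _))

  sumℚ-pairSum : ∀ {n} (f : Fin n → Fin n → ℚ) (g : Fin n → Fin n → ℕ) →
    (∀ u v → f u v ≡ ℕ→ℚ (g u v)) → sumℚ (pairsWith f) ≡ ℕ→ℚ (pairSum g)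
  sumℚ-pairSum f g e = pairsWith-pairSum (λ xs k → sumℚ xs ≡ ℕ→ℚ k) refl (λ {xs} {ys} {a} {b} → sumℚ-++ {xs} {ys} {a} {b}) (λ u v → trans (ℚ.+-identityʳ _) (e u v))

  ∈?-count : ∀ n xs → sum {n} (λ v → 𝟙 (does (toℕ v ∈? xs))) ≤ length xs
  ∈?-count n [] = ≤-reflexive (sum-zero {n} λ _ → refl)
  ∈?-count n (x ∷ xs) = begin
    sum {n} (λ v → 𝟙 (does (toℕ v ∈? x ∷ xs)))
      ≤⟨ (sum-mono {n} λ v → or-plus (does (toℕ v ≟ x)) (does (toℕ v ∈? xs))) ⟩
    sum {n} (λ v → 𝟙 (does (toℕ v ≟ x)) + 𝟙 (does (toℕ v ∈? xs)))
      ≡⟨ ∑-distrib-+ {n} (λ v → 𝟙 (does (toℕ v ≟ x))) (λ v → 𝟙 (does (toℕ v ∈? xs))) ⟩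
    sum {n} (λ v → 𝟙 (does (toℕ v ≟ x))) + sum {n} (λ v → 𝟙 (does (toℕ v ∈? xs)))
      ≤⟨ +-mono-≤ (once n x) (∈?-count n xs) ⟩
    suc (length xs) ∎
    where
    open ≤-Reasoning
    or-plus : ∀ a b → 𝟙 (a ∨ b) ≤ 𝟙 a + 𝟙 b
    or-plus true b = s≤s z≤n
    or-plus false b = ≤-refl
    once : ∀ n x → sum {n} (λ v → 𝟙 (does (toℕ v ≟ x))) ≤ 1
    once zero x = z≤n
    once (suc n) zero = s≤s (≤-reflexive (sum-zero {n} λ _ → refl))
    once (suc n) (suc x) = once n x

  countTrue-map : ∀ {n m} (f : Fin m → Bool) (e : Fin n → Fin m) → countTrue (map f (tabulate e)) ≡ sum (𝟙 ∘ f ∘ e)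
  countTrue-map {zero} f e = refl
  countTrue-map {suc n} f e with f (e Fin.zero)
  ... | true = cong suc (countTrue-map f (e ∘ Fin.suc))
  ... | false = countTrue-map f (e ∘ Fin.suc)

  ≤-pairSum : ∀ {n} (f g : Fin n → Fin n → ℕ) → (∀ u v → f u v ≢ 0 → toℕ u < toℕ v × f u v ≤ g u v) →
    (sum λ u → sum λ v → f u v) ≤ pairSum g
  ≤-pairSum {n} f g h = sum-mono {n} λ u → sum-mono {n} λ v → term u v
    where
    term : ∀ u v → f u v ≤ (if toℕ u <ᵇ toℕ v then g u v else 0)
    term u v with f u v ≟ 0
    ... | yes e = ≤-trans (≤-reflexive e) z≤n
    ... | no ne rewrite <ᵇ-true (proj₁ (h u v ne)) = proj₂ (h u v ne)

  nonzero : ℕ → Bool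
  nonzero zero    = false
  nonzero (suc _) = true

  nonzero-inv : ∀ {k} → nonzero k ≡ true → k ≢ 0
  nonzero-inv {suc k} _ ()

  nonzero-true : ∀ {k} → k ≢ 0 → nonzero k ≡ true
  nonzero-true {zero} k≢0 = ⊥-elim (k≢0 refl)
  nonzero-true {suc k} _ = refl

  module Network (h L n′ : ℕ) where
    open Chords h
    open Elimination h using (bags; bags-self; bags-own; bags-parent; bags-length; bags-root; bags-chord; parent; parent-bound; own; own-bound; rank; rank-parent)

    n : ℕ
    n = suc n′

    -- The value 0 stands for no edge. Since chords go forward and span more than one unit step, at
    -- most one of the summands is non-zero, and the sums act as case distinctions.
    δ ν : ℕ → ℕ → ℕ
    δ a b = 𝟙 (b ≡ᵇ suc a) + ω L a b
    ν a b = δ a b + δ b a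

    ω-zero : ∀ a b → ¬ suc a < b → ω L a b ≡ 0
    ω-zero a b ≮ with ω L a b ≟ 0
    ... | yes e = e
    ... | no ne = ⊥-elim (≮ (ω-pos⇒< L a b ne))

    δ-path : ∀ a → δ a (suc a) ≡ 1
    δ-path a rewrite ≡ᵇ-refl a | ω-zero a (suc a) (<-irrefl refl) = refl

    δ-backward : ∀ {a b} → b ≤ a → δ a b ≡ 0
    δ-backward {a} {b} b≤a rewrite ≡ᵇ-false {b} {suc a} (λ { refl → <-irrefl refl b≤a }) =
      ω-zero a b λ lt → <-irrefl refl (<-≤-trans (<-trans ≤-refl lt) b≤a)

    data Forward (a b : ℕ) : Set where
      path  : b ≡ suc a → Forward a b
      chord : Chord L a b (δ a b) → Forward a b

    forward : ∀ a b → δ a b ≢ 0 → Forward a b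
    forward a b δ≢0 with b ≟ suc a
    ... | yes e = path e
    ... | no ne with ω-chord L a b | ≡ᵇ-false ne
    ...   | c | e = chord (subst (Chord L a b) (sym δ≡ω) (c (δ≢0 ∘ trans δ≡ω)))
      where
      δ≡ω : δ a b ≡ ω L a b
      δ≡ω = cong (λ t → 𝟙 t + ω L a b) e

    ν-forward : ∀ {a b} → a ≤ b → ν a b ≡ δ a b
    ν-forward {a} {b} a≤b rewrite δ-backward {b} {a} a≤b = +-identityʳ _

    ν-sym : ∀ a b → ν a b ≡ ν b a
    ν-sym a b = +-comm (δ a b) (δ b a)

    orient : ∀ a b → ν a b ≢ 0 → δ a b ≢ 0 × ν a b ≡ δ a b ⊎ δ b a ≢ 0 × ν a b ≡ δ b a
    orient a b ν≢0 with ≤-total a b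
    ... | inj₁ a≤b = inj₁ (ν≢0 ∘ trans (ν-forward a≤b) , ν-forward a≤b)
    ... | inj₂ b≤a = inj₂ (ν≢0 ∘ trans e , e)
      where
      e : ν a b ≡ δ b a
      e = trans (ν-sym a b) (ν-forward b≤a)

    ν-path : ∀ a → ν a (suc a) ≡ 1
    ν-path a = trans (ν-forward (n≤1+n a)) (δ-path a)

    ν-irrefl : ∀ a → ν a a ≡ 0
    ν-irrefl a = cong₂ _+_ (δ-backward {a} ≤-refl) (δ-backward {a} ≤-refl)

    edge : Fin n → Fin n → Bool
    edge u v = nonzero (ν (toℕ u) (toℕ v))

    network : WGraph n
    network = record
      { graph = record
        { adj = edge
        ; irrefl = λ u → cong nonzero (ν-irrefl (toℕ u))
        ; symm = λ u v → cong nonzero (ν-sym (toℕ u) (toℕ v)) }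
      ; wt = λ u v → ℕ→ℚ (ν (toℕ u) (toℕ v))
      ; wt-symm = λ u v → cong ℕ→ℚ (ν-sym (toℕ u) (toℕ v))
      ; wt-pos = λ u v e → positive (ν (toℕ u) (toℕ v)) (nonzero-inv e) }
      where
      positive : ∀ k → k ≢ 0 → 0ℚ ℚ.< ℕ→ℚ k
      positive zero k≢0 = ⊥-elim (k≢0 refl)
      positive (suc k) _ = ℕ→ℚ->0 k

    -- The path as a spanning tree

    private
      pred-< : ∀ (v : Fin n) → v ≢ Fin.zero → toℕ (Fin.pred v) < toℕ v
      pred-< Fin.zero v≢0 = ⊥-elim (v≢0 refl)
      pred-< (Fin.suc v) _ = s≤s (≤-reflexive (Fin.toℕ-inject₁ v))

      module Path = ParentTree {n′} Fin.pred toℕ pred-<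

    path-child : ∀ u v → Path.child u v ≡ true → toℕ v ≡ suc (toℕ u)
    path-child u v e with Path.child-inv u v e
    path-child u Fin.zero e | v≢0 , _ = ⊥-elim (v≢0 refl)
    path-child u (Fin.suc v) e | _ , refl = cong suc (sym (Fin.toℕ-inject₁ v))

    path-ν : ∀ u v → SGraph.adj Path.tree u v ≡ true → ν (toℕ u) (toℕ v) ≡ 1
    path-ν u v e with Path.child u v in e₁ | Path.child v u in e₂
    ... | true | _ rewrite path-child u v e₁ = ν-path (toℕ u)
    ... | false | true rewrite path-child v u e₂ = trans (ν-sym (suc (toℕ v)) (toℕ v)) (ν-path (toℕ v))

    path-edge : ∀ u v → SGraph.adj Path.tree u v ≡ true → edge u v ≡ true
    path-edge u v e = cong nonzero (path-ν u v e)

    pathTree : Subgraph network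
    pathTree = record { sel = SGraph.adj Path.tree ; sel-symm = SGraph.symm Path.tree ; sel-sub = path-edge }

    pathTree-spanning : IsSpanningTree network pathTree
    pathTree-spanning = Path.isTree

    connected : Connected network
    connected u v = map-walk (λ {a} {b} → path-edge a b) (proj₁ Path.isTree u v)

    kept : Subgraph network → Fin n → Fin n → ℕ
    kept H u v = if Subgraph.sel H u v then ν (toℕ u) (toℕ v) else 0

    weight-pairSum : ∀ H → weight network H ≡ ℕ→ℚ (pairSum (kept H))
    weight-pairSum H = sumℚ-pairSum _ (kept H) λ u v → sym (𝔹.if-float ℕ→ℚ (Subgraph.sel H u v))

    pathTree-weight : weight network pathTree ≡ ℕ→ℚ n′
    pathTree-weight = trans (weight-pairSum pathTree) (cong ℕ→ℚ (begin
      pairSum (kept pathTree)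
        ≡⟨ (sum-cong-≗ λ u → sum-cong-≗ λ v → cong (λ x → if toℕ u <ᵇ toℕ v then x else 0) (each u v)) ⟩
      pairSum (λ u v → 𝟙 (sel u v))
        ≡⟨ edgeCount-pairSum sel ⟨
      edgeCount sel
        ≡⟨ proj₂ Path.isTree ⟩
      n′ ∎))
      where
      open ≡-Reasoning
      sel : Fin n → Fin n → Bool
      sel = Subgraph.sel pathTree
      each : ∀ u v → kept pathTree u v ≡ 𝟙 (sel u v)
      each u v with sel u v in e
      ... | true = path-ν u v e
      ... | false = refl

    -- Spanners keep all chords

    module _ {u v : Fin n} {w : ℕ} (P : Potential L (toℕ u) (toℕ v) w) (H : Subgraph network)
             (missing : Subgraph.sel H u v ≡ false) where
      open Potential P
      open Subgraph H

      edge-lip : ∀ x y → sel x y ≡ true → f (toℕ y) ≤ f (toℕ x) + ν (toℕ x) (toℕ y)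
      edge-lip x y e with orient (toℕ x) (toℕ y) (nonzero-inv (sel-sub x y e))
      ... | inj₁ (δ≢0 , eq) rewrite eq with forward (toℕ x) (toℕ y) δ≢0
      ...   | path next rewrite next | δ-path (toℕ x) | +-comm (f (toℕ x)) 1 = step↑ (toℕ x)
      ...   | chord c = proj₂ (lip c λ { (x≡u , y≡v) → 𝔹.not-¬ e (trans (cong₂ sel (Fin.toℕ-injective x≡u) (Fin.toℕ-injective y≡v)) missing) })
      edge-lip x y e | inj₂ (δ≢0 , eq) rewrite eq with forward (toℕ y) (toℕ x) δ≢0
      ...   | path next rewrite next | δ-path (toℕ y) | +-comm (f (suc (toℕ y))) 1 = step↓ (toℕ y)
      ...   | chord c = proj₁ (lip c λ { (y≡u , x≡v) → 𝔹.not-¬ e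
              (trans (cong₂ sel (Fin.toℕ-injective x≡v) (Fin.toℕ-injective y≡u)) (trans (sel-symm v u) missing)) })

      -- Returning the weight as a natural number lets the comparison with the potential take place
      -- in ℕ.
      walk-lip : ∀ {x y} (q : WalkIn network H x y) →
        ∃[ W ] (walkWeight (WGraph.wt network) q ≡ ℕ→ℚ W × f (toℕ y) ≤ f (toℕ x) + W)
      walk-lip {x} [] = 0 , refl , ≤-reflexive (sym (+-identityʳ _))
      walk-lip {x} {y} (_∷_ {v = z} e q) = let W , eq , le = walk-lip q in
          ν (toℕ x) (toℕ z) + W
          , trans (cong (ℕ→ℚ (ν (toℕ x) (toℕ z)) ℚ.+_) eq) (sym (ℕ→ℚ-+ (ν (toℕ x) (toℕ z)) W))
          , (begin
            f (toℕ y)                                     ≤⟨ le ⟩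
            f (toℕ z) + W                                 ≤⟨ +-monoˡ-≤ W (edge-lip x z e) ⟩
            f (toℕ x) + ν (toℕ x) (toℕ z) + W             ≡⟨ +-assoc (f (toℕ x)) _ W ⟩
            f (toℕ x) + (ν (toℕ x) (toℕ z) + W)           ∎)
        where open ≤-Reasoning

    module _ (ε : ℚ) (εp<1 : ε ℚ.* ℕ→ℚ p ℚ.< 1ℚ) (H : Subgraph network) (spanner : IsSpanner network ε H) where
      open Subgraph H

      -- If the chord were missing, the spanner condition for the one-edge walk along it would give
      -- a walk in H around it. By the potential this walk weighs at least `m / p` times the chord,
      -- beyond the factor 1 + ε.
      chord-kept : ∀ u v → ω L (toℕ u) (toℕ v) ≢ 0 → sel u v ≡ true
      chord-kept u v ω≢0 = 𝔹.¬-not λ missing → detour missing (spanner u v (adjacent ∷ []))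
        where
        a = toℕ u
        b = toℕ v
        c : Chord L a b (ω L a b)
        c = ω-chord L a b ω≢0
        open Potential (potential c)
        adjacent : edge u v ≡ true
        adjacent = nonzero-true λ e → ω≢0 (m+n≡0⇒n≡0 _ (m+n≡0⇒m≡0 (δ a b) e))
        w≡ : ν a b ≡ ω L a b
        w≡ = trans (ν-forward (<⇒≤ (<-trans ≤-refl (chord-long c))))
               (cong (λ t → 𝟙 t + ω L a b) (≡ᵇ-false (>⇒≢ (chord-long c))))
        long : ∀ W → f b ≤ f a + W → m * ω L a b ≤ p * W
        long W f≤ = subst (_≤ p * W) at-v (*-monoʳ-≤ p (subst (λ z → f b ≤ z + W) at-u f≤))
        detour : sel u v ≡ false → ¬ Σ (WalkIn network H u v) λ q →
          walkWeight (WGraph.wt network) q ℚ.≤ (1ℚ ℚ.+ ε) ℚ.* (ℕ→ℚ (ν a b) ℚ.+ 0ℚ)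
        detour missing (q , le) = too-short (walk-lip (potential c) H missing q)
          where
          too-short : ¬ (∃[ W ] (walkWeight (WGraph.wt network) q ≡ ℕ→ℚ W × f b ≤ f a + W))
          too-short (W , eq , f≤) = no-detour ε p εp<1 (ω L a b) W (chord-weight c) bound (long W f≤)
            where
            bound : ℕ→ℚ W ℚ.≤ (1ℚ ℚ.+ ε) ℚ.* ℕ→ℚ (ω L a b)
            bound = subst₂ (λ s t → s ℚ.≤ (1ℚ ℚ.+ ε) ℚ.* t) eq (trans (ℚ.+-identityʳ (ℕ→ℚ (ν a b))) (cong ℕ→ℚ w≡)) le

      spanner-heavy : ℕ→ℚ (S L n) ℚ.≤ weight network H
      spanner-heavy = ℚ.≤-trans (ℕ→ℚ-mono (S L n) (pairSum (kept H)) (≤-pairSum (λ u v → ω L (toℕ u) (toℕ v)) (kept H) counted))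
                                (ℚ.≤-reflexive (sym (weight-pairSum H)))
        where
        counted : ∀ u v → ω L (toℕ u) (toℕ v) ≢ 0 → toℕ u < toℕ v × ω L (toℕ u) (toℕ v) ≤ kept H u v
        counted u v ω≢0 = <-trans ≤-refl (ω-pos⇒< L (toℕ u) (toℕ v) ω≢0)
          , subst (λ t → ω L (toℕ u) (toℕ v) ≤ (if t then ν (toℕ u) (toℕ v) else 0)) (sym (chord-kept u v ω≢0))
              (≤-trans (m≤n+m (ω L (toℕ u) (toℕ v)) (𝟙 (toℕ v ≡ᵇ suc (toℕ u)))) (m≤m+n (δ (toℕ u) (toℕ v)) (δ (toℕ v) (toℕ u))))

    -- The tree decomposition of the network

    treewidth : TreewidthAtMost 4 network
    treewidth = record
      { m = suc M
      ; tree = tree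
      ; isTree = isTree
      ; bag = bag
      ; bagSize = λ i → ≤-trans (≤-reflexive (countTrue-map (bag i) id))
                          (≤-trans (∈?-count n (bags L (toℕ i))) (bags-length L (toℕ i)))
      ; coverV = λ v → node v , in-node v
      ; coverE = coverE
      ; subtree = λ v i j bi bj → to-node v i bi ++ʷ reverse-walk (reversed v) (to-node v j bj) }
      where
      -- Parents can exceed n, so the tree gets nodes beyond the vertices, up to a multiple of
      -- `K ^ L` to which `parent-bound` applies.
      M = n * K ^ L
      parentᶠ : Fin (suc M) → Fin (suc M)
      parentᶠ i = Fin.fromℕ< (s≤s (parent-bound L n (toℕ i) (s≤s⁻¹ (Fin.toℕ<n i))))
      toℕ-parentᶠ : ∀ i → toℕ (parentᶠ i) ≡ parent L (toℕ i)
      toℕ-parentᶠ i = Fin.toℕ-fromℕ< (s≤s (parent-bound L n (toℕ i) (s≤s⁻¹ (Fin.toℕ<n i))))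
      open ParentTree parentᶠ (rank L ∘ toℕ) (λ v v≢0 →
        subst (λ x → rank L x < rank L (toℕ v)) (sym (toℕ-parentᶠ v)) (rank-parent L (toℕ v) (v≢0 ∘ Fin.toℕ-injective)))
      bag : Fin (suc M) → Fin n → Bool
      bag i v = does (toℕ v ∈? bags L (toℕ i))
      bag-true : ∀ i v → toℕ v ∈ bags L (toℕ i) → bag i v ≡ true
      bag-true i v = dec-true (toℕ v ∈? bags L (toℕ i))
      bag-inv : ∀ i v → bag i v ≡ true → toℕ v ∈ bags L (toℕ i)
      bag-inv i v e with toℕ v ∈? bags L (toℕ i)
      ... | yes v∈ = v∈
      n≤M : n ≤ M
      n≤M = ≤-trans (≤-reflexive (sym (*-identityʳ n))) (*-monoʳ-≤ n (m^n>0 K L))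
      node-at : ∀ a → a ≤ n → Fin (suc M)
      node-at a a≤n = Fin.fromℕ< (s≤s (≤-trans a≤n n≤M))
      node : Fin n → Fin (suc M)
      node v = node-at (toℕ v) (<⇒≤ (Fin.toℕ<n v))
      in-node-at : ∀ a (a≤n : a ≤ n) v → toℕ v ∈ bags L a → bag (node-at a a≤n) v ≡ true
      in-node-at a a≤n v v∈ = bag-true (node-at a a≤n) v (subst (λ x → toℕ v ∈ bags L x) (sym (Fin.toℕ-fromℕ< (s≤s (≤-trans a≤n n≤M)))) v∈)
      in-node : ∀ v → bag (node v) v ≡ true
      in-node v = in-node-at (toℕ v) (<⇒≤ (Fin.toℕ<n v)) v (bags-self L (toℕ v))
      cover : ∀ u v → δ (toℕ u) (toℕ v) ≢ 0 → Σ (Fin (suc M)) λ i → bag i u ≡ true × bag i v ≡ true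
      cover u v δ≢0 with forward (toℕ u) (toℕ v) δ≢0
      ... | chord c = node v , in-node-at (toℕ v) (<⇒≤ (Fin.toℕ<n v)) u (bags-chord c) , in-node v
      ... | path e = node-at a a≤n , in-node-at a a≤n u (proj₁ (bags-own L (toℕ u)))
                   , in-node-at a a≤n v (subst (_∈ bags L a) (sym e) (proj₂ (bags-own L (toℕ u))))
        where
        a = own L (toℕ u)
        a≤n : a ≤ n
        a≤n = ≤-trans (own-bound L (toℕ u)) (Fin.toℕ<n u)
      coverE : ∀ u v → edge u v ≡ true → Σ (Fin (suc M)) λ i → bag i u ≡ true × bag i v ≡ true
      coverE u v e with orient (toℕ u) (toℕ v) (nonzero-inv e)
      ... | inj₁ (δ≢0 , _) = cover u v δ≢0
      ... | inj₂ (δ≢0 , _) with cover v u δ≢0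
      ...   | i , bv , bu = i , bu , bv
      reversed : ∀ v {a b} → SGraph.adj tree a b ≡ true × bag a v ≡ true × bag b v ≡ true →
        SGraph.adj tree b a ≡ true × bag b v ≡ true × bag a v ≡ true
      reversed v {a} {b} (e , ba , bb) = trans (SGraph.symm tree b a) e , bb , ba
      to-node : ∀ v i → bag i v ≡ true → Walk (λ a b → SGraph.adj tree a b ≡ true × bag a v ≡ true × bag b v ≡ true) i (node v)
      to-node v i bi = walk-up (λ i → bag i v ≡ true) (node v) closed i bi
        where
        closed : ∀ i → bag i v ≡ true → i ≢ node v → i ≢ Fin.zero × bag (parentᶠ i) v ≡ true
        closed i bi i≢ = i≢0 , bag-true (parentᶠ i) v (subst (λ x → toℕ v ∈ bags L x) (sym (toℕ-parentᶠ i)) (bags-parent L (toℕ i) v∈ v≢i))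
          where
          v∈ = bag-inv i v bi
          toℕ-node : toℕ (node v) ≡ toℕ v
          toℕ-node = Fin.toℕ-fromℕ< (s≤s (≤-trans (<⇒≤ (Fin.toℕ<n v)) n≤M))
          v≢i : toℕ v ≢ toℕ i
          v≢i e = i≢ (Fin.toℕ-injective (trans (sym e) (sym toℕ-node)))
          i≢0 : i ≢ Fin.zero
          i≢0 refl = v≢i (bags-root L v∈)

  -- Constants and conclusion

  module _ (h : ℕ) {x : ℚ} (1<x : 1ℚ ℚ.< x) where
    open Chords h

    -- For p ≥ 2 one has `K ≤ p ^ 3` and `m * 3 ≤ 6 * p`, so `K ^ m` is at most `x ^ℚ k` as soon as
    -- k is at least 6x. This is the origin of the constant 6.
    enough-vertices : ∀ n k → ℕ→ℚ p ℚ.< x → ℕ→ℚ 6 ℚ.* x ℚ.≤ ℕ→ℚ k → ℕ→ℚ 16 ℚ.* x ^ℚ k ℚ.≤ ℕ→ℚ n → K ^ m ≤ n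
    enough-vertices n k p<x 6x≤k 16xᵏ≤n = ℕ→ℚ-cancel (K ^ m) n (ℚ.≤-trans (size h refl) 16xᵏ≤n)
      where
      1≤x = ℚ.<⇒≤ 1<x
      1≤xᵏ = ^ℚ-≥1 1≤x k
      3m≤k : 2 ≤ p → m * 3 ≤ k
      3m≤k 2≤p = ≤-trans 3m≤6p (ℕ→ℚ-cancel (6 * p) k (ℚ.≤-trans (ℚ.≤-reflexive (ℕ→ℚ-* 6 p)) (ℚ.≤-trans (*-monoˡ (ℕ→ℚ-≥0 6) (ℚ.<⇒≤ p<x)) 6x≤k)))
        where
        3m≤6p : m * 3 ≤ 6 * p
        3m≤6p = ≤-trans (+-monoˡ-≤ (p * 3) (*-monoˡ-≤ 3 (s≤s (z≤n {h})))) (≤-reflexive (ring p))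
          where
          ring : ∀ p → p * 3 + p * 3 ≡ 6 * p
          ring = solve-∀
      K≤p³ : 2 ≤ p → K ≤ p ^ 3
      K≤p³ 2≤p = begin
        m + m                ≡⟨ ring₁ p ⟩
        2 * p + 2            ≤⟨ +-monoʳ-≤ (2 * p) (≤-trans 2≤p (m≤m+n p (p + 0))) ⟩
        2 * p + 2 * p        ≡⟨ ring₂ p ⟩
        p * (2 * 2)          ≤⟨ *-monoʳ-≤ p (*-mono-≤ 2≤p (≤-trans 2≤p (≤-reflexive (sym (*-identityʳ p))))) ⟩
        p ^ 3                ∎
        where
        open ≤-Reasoning
        ring₁ : ∀ p → suc p + suc p ≡ 2 * p + 2
        ring₁ = solve-∀
        ring₂ : ∀ p → 2 * p + 2 * p ≡ p * 4
        ring₂ = solve-∀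
      large : 2 ≤ p → ℕ→ℚ (K ^ m) ℚ.≤ ℕ→ℚ 16 ℚ.* x ^ℚ k
      large 2≤p = begin
        ℕ→ℚ (K ^ m)          ≤⟨ ℕ→ℚ-mono (K ^ m) ((p ^ 3) ^ m) (^-monoˡ-≤ m (K≤p³ 2≤p)) ⟩
        ℕ→ℚ ((p ^ 3) ^ m)    ≡⟨ cong ℕ→ℚ (trans (^-*-assoc p 3 m) (cong (p ^_) (*-comm 3 m))) ⟩
        ℕ→ℚ (p ^ (m * 3))    ≤⟨ ℕ→ℚ-^ p (ℚ.<⇒≤ p<x) (m * 3) ⟩
        x ^ℚ (m * 3)         ≤⟨ ^ℚ-mono-exp 1≤x (3m≤k 2≤p) ⟩
        x ^ℚ k               ≡⟨ ℚ.*-identityˡ (x ^ℚ k) ⟨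
        1ℚ ℚ.* x ^ℚ k        ≤⟨ *-monoʳ (ℚ.≤-trans (ℕ→ℚ-≥0 1) 1≤xᵏ) (ℕ→ℚ-mono 1 16 (s≤s z≤n)) ⟩
        ℕ→ℚ 16 ℚ.* x ^ℚ k    ∎
        where open ℚ.≤-Reasoning
      size : ∀ h′ → h ≡ h′ → ℕ→ℚ (K ^ m) ℚ.≤ ℕ→ℚ 16 ℚ.* x ^ℚ k
      -- For p = 1 the number x may be barely above 1, and its powers are of no help. But then m = 2
      -- and K = 4, so `K ^ m` is the constant 16.
      size zero refl = ℚ.≤-trans (ℚ.≤-reflexive (sym (ℚ.*-identityʳ (ℕ→ℚ 16)))) (*-monoˡ (ℕ→ℚ-≥0 16) 1≤xᵏ)
      size (suc h′) refl = large (s≤s (s≤s z≤n))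

    -- The 16 combines the 4 of `chords-heavy` with two losses of a factor 2: m ≤ 2p, and the
    -- rounding of n down to a multiple of `K ^ m`.
    chords-vs-path : ∀ n → K ^ m ≤ n → m * m * n ≤ 16 * S m n
    chords-vs-path n Q≤n = begin
      m * m * n                      ≤⟨ *-mono-≤ (*-monoʳ-≤ m m≤2p) n≤2NQ ⟩
      m * (2 * p) * (2 * (N * Q))    ≡⟨ ring m p (N * Q) ⟩
      4 * (N * Q * (m * p))          ≤⟨ *-monoʳ-≤ 4 (chords-heavy N n (m/n*n≤m n Q)) ⟩
      4 * (4 * S m n)                ≡⟨ *-assoc 4 4 (S m n) ⟨
      16 * S m n                     ∎
      where
      open ≤-Reasoning
      Q = K ^ m
      instance
        Q≢0 : NonZero Q
        Q≢0 = m^n≢0 K m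
      N = n / Q
      ring : ∀ m p x → m * (2 * p) * (2 * x) ≡ 4 * (x * (m * p))
      ring = solve-∀
      m≤2p : m ≤ 2 * p
      m≤2p = s≤s (≤-trans (m≤m+n (suc h) 0) (m≤n+m (suc h + 0) h))
      n≤2NQ : n ≤ 2 * (N * Q)
      n≤2NQ = begin
        n                  ≡⟨ m≡m%n+[m/n]*n n Q ⟩
        n % Q + N * Q      ≤⟨ +-monoˡ-≤ (N * Q) (<⇒≤ (m%n<n n Q)) ⟩
        Q + N * Q          ≡⟨ cong (_+ N * Q) (*-identityˡ Q) ⟨
        1 * Q + N * Q      ≤⟨ +-monoˡ-≤ (N * Q) (*-monoˡ-≤ Q (m≥n⇒m/n>0 Q≤n)) ⟩
        N * Q + N * Q      ≡⟨ cong (N * Q +_) (+-identityʳ (N * Q)) ⟨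
        2 * (N * Q)        ∎

  1/16 : ℚ
  1/16 = ℚ.1/ ℕ→ℚ 16

  1/16>0 : 0ℚ ℚ.< 1/16
  1/16>0 = toWitness {a? = 0ℚ ℚ.<? 1/16} _

  1/16≥0 : 0ℚ ℚ.≤ 1/16
  1/16≥0 = ℚ.<⇒≤ 1/16>0

  lightness-bound : ∀ {x} m n s → 1ℚ ℚ.≤ x → x ℚ.≤ ℕ→ℚ m → m * m * suc n ≤ 16 * s →
    (1/16 ℚ.* x ^ℚ 2) ℚ.* ℕ→ℚ n ℚ.≤ ℕ→ℚ s
  lightness-bound {x} m n s 1≤x x≤m m²n≤16s = begin
    (1/16 ℚ.* x ^ℚ 2) ℚ.* ℕ→ℚ n
      ≡⟨ ℚ.*-assoc 1/16 (x ^ℚ 2) (ℕ→ℚ n) ⟩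
    1/16 ℚ.* (x ^ℚ 2 ℚ.* ℕ→ℚ n)
      ≤⟨ *-monoˡ 1/16≥0 (*-mono (ℚ.≤-trans (ℕ→ℚ-≥0 1) (^ℚ-≥1 1≤x 2)) x²≤m² (ℕ→ℚ-≥0 n) (ℕ→ℚ-mono n (suc n) (n≤1+n n))) ⟩
    1/16 ℚ.* (ℕ→ℚ (m * m) ℚ.* ℕ→ℚ (suc n))
      ≡⟨ cong (1/16 ℚ.*_) (ℕ→ℚ-* (m * m) (suc n)) ⟨
    1/16 ℚ.* ℕ→ℚ (m * m * suc n)
      ≤⟨ *-monoˡ 1/16≥0 (ℕ→ℚ-mono (m * m * suc n) (16 * s) m²n≤16s) ⟩
    1/16 ℚ.* ℕ→ℚ (16 * s)
      ≡⟨ trans (cong (1/16 ℚ.*_) (ℕ→ℚ-* 16 s)) (sym (ℚ.*-assoc 1/16 (ℕ→ℚ 16) (ℕ→ℚ s))) ⟩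
    1ℚ ℚ.* ℕ→ℚ s
      ≡⟨ ℚ.*-identityˡ (ℕ→ℚ s) ⟩
    ℕ→ℚ s ∎
    where
    open ℚ.≤-Reasoning
    x²≤m² : x ^ℚ 2 ℚ.≤ ℕ→ℚ (m * m)
    x²≤m² = begin
      x ℚ.* (x ℚ.* 1ℚ)     ≡⟨ cong (x ℚ.*_) (ℚ.*-identityʳ x) ⟩
      x ℚ.* x              ≤⟨ *-mono 0≤x x≤m 0≤x x≤m ⟩
      ℕ→ℚ m ℚ.* ℕ→ℚ m      ≡⟨ ℕ→ℚ-* m m ⟨
      ℕ→ℚ (m * m)          ∎
      where
      0≤x : 0ℚ ℚ.≤ x
      0≤x = ℚ.≤-trans (ℕ→ℚ-≥0 1) 1≤x

  module _ (ε : ℚ) (ε>0 : 0ℚ ℚ.< ε) (ε<1 : ε ℚ.< 1ℚ) where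
    private
      x : ℚ
      x = inv ε ε>0

    ε*inv : ε ℚ.* x ≡ 1ℚ
    ε*inv = ℚ.*-inverseʳ ε {{ℚ.>-nonZero ε>0}}

    inv>1 : 1ℚ ℚ.< x
    inv>1 = ℚ.≰⇒> λ x≤1 → ℚ.<-irrefl refl (begin-strict
      1ℚ          ≡⟨ ε*inv ⟨
      ε ℚ.* x     ≤⟨ *-monoˡ (ℚ.<⇒≤ ε>0) x≤1 ⟩
      ε ℚ.* 1ℚ    ≡⟨ ℚ.*-identityʳ ε ⟩
      ε           <⟨ ε<1 ⟩
      1ℚ          ∎)
      where open ℚ.≤-Reasoning

    ε*-<1 : ∀ {y} → y ℚ.< x → ε ℚ.* y ℚ.< 1ℚ
    ε*-<1 {y} y<x = subst (ε ℚ.* y ℚ.<_) ε*inv (ℚ.*-monoʳ-<-pos ε {{ℚ.positive ε>0}} y<x)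

    heavy-spanners : ∀ n k → ℕ→ℚ 6 ℚ.* x ℚ.≤ ℕ→ℚ k → ℕ→ℚ 16 ℚ.* (x ^ℚ k) ℚ.≤ ℕ→ℚ n →
      Σ (WGraph n) λ G → Connected G × TreewidthAtMost 4 G ×
        (∀ (H : Subgraph G) → IsSpanner G ε H → ∀ (T : Subgraph G) → IsMST G T →
         weight G H ℚ.≥ (1/16 ℚ.* (x ^ℚ 2)) ℚ.* weight G T)
    heavy-spanners n k 6x≤k 16xᵏ≤n
      with ceiling inv>1 k (ℚ.≤-trans (ℚ.≤-trans (ℚ.≤-reflexive (sym (ℚ.*-identityˡ x)))
             (*-monoʳ (ℚ.≤-trans (ℕ→ℚ-≥0 1) (ℚ.<⇒≤ inv>1)) (ℕ→ℚ-mono 1 6 (s≤s z≤n)))) 6x≤k)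
    ... | h , p<x , x≤m with enough-vertices h inv>1 n k p<x 6x≤k 16xᵏ≤n
    heavy-spanners zero k _ _ | h , _ , _ | Kᵐ≤0 = ⊥-elim (≢-nonZero⁻¹ _ {{m^n≢0 (Chords.K h) (Chords.m h)}} (n≤0⇒n≡0 Kᵐ≤0))
    heavy-spanners (suc n′) k _ _ | h , p<x , x≤m | Kᵐ≤n = network , connected , treewidth , heavy
      where
      open Chords h using (m; S)
      open Network h m n′
      heavy : ∀ (H : Subgraph network) → IsSpanner network ε H → ∀ (T : Subgraph network) → IsMST network T →
        weight network H ℚ.≥ (1/16 ℚ.* (x ^ℚ 2)) ℚ.* weight network T
      heavy H spanner T (_ , minimal) = begin
        (1/16 ℚ.* x ^ℚ 2) ℚ.* weight network T
          ≤⟨ *-monoˡ (*-≥0 1/16≥0 (ℚ.≤-trans (ℕ→ℚ-≥0 1) (^ℚ-≥1 (ℚ.<⇒≤ inv>1) 2))) (minimal pathTree pathTree-spanning) ⟩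
        (1/16 ℚ.* x ^ℚ 2) ℚ.* weight network pathTree
          ≡⟨ cong ((1/16 ℚ.* x ^ℚ 2) ℚ.*_) pathTree-weight ⟩
        (1/16 ℚ.* x ^ℚ 2) ℚ.* ℕ→ℚ n′
          ≤⟨ lightness-bound m n′ (S m (suc n′)) (ℚ.<⇒≤ inv>1) x≤m (chords-vs-path h inv>1 (suc n′) Kᵐ≤n) ⟩
        ℕ→ℚ (S m (suc n′))
          ≤⟨ spanner-heavy ε (ε*-<1 p<x) H spanner ⟩
        weight network H ∎
        where open ℚ.≤-Reasoning

open import Data.Nat using (ℕ)
open import Data.Rational using (ℚ; 0ℚ; 1ℚ; _*_; _<_; _≤_; _≥_)
open import Data.Product using (Σ; ∃-syntax; _×_; _,_)

theorem4p1 : ∃[ c ] ∃[ C ] ∃[ d ] (0ℚ < c × 0ℚ < C × 0ℚ < d ×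
    (∀ (ε : ℚ) (ε>0 : 0ℚ < ε) → ε < 1ℚ →
    ∀ (n k : ℕ) → d * inv ε ε>0 ≤ ℕ→ℚ k → C * (inv ε ε>0 ^ℚ k) ≤ ℕ→ℚ n →
    Σ (WGraph n) λ G → Connected G × TreewidthAtMost 4 G ×
    (∀ (H : Subgraph G) → IsSpanner G ε H →
    ∀ (T : Subgraph G) → IsMST G T →
    weight G H ≥ ((c * (inv ε ε>0 ^ℚ 2)) * weight G T))))
theorem4p1 = 1/16 , ℕ→ℚ 16 , ℕ→ℚ 6 , 1/16>0 , ℕ→ℚ->0 15 , ℕ→ℚ->0 5 , heavy-spanners
  where open Construction
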